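{- Let $\mu\subseteq\lambda$ be partitions and $n\ge\ell(\lambda)$. The number of highest weight valued-set tableaux in $\mathrm{VST}^n(\lambda)$ of weight $\mu$ equals the number of reverse plane partitions of skew shape $\lambda/\mu$ all of whose entries in the $i$-th row lie in the closed interval $[\mu_1+1-\mu_i,\mu_1]$, for each $i$.
   Context: A reverse plane partition of shape $\lambda/\mu$ is a filling of the boxes of $\lambda$ not in $\mu$ (English convention) by positive integers weakly increasing along rows and down columns. A valued-set tableau of shape $\lambda$ with entries at most $n$ is a semistandard Young tableau of shape $\lambda$ with entries in $\{1,\dots,n\}$, together with a division of each row into groups, each group a set of horizontally consecutive boxes of one row containing the same entry. Buoy/anchor: leftmost/rightmost box of a group. The weight is $(m_1,m_2,\dots)$, $m_j$ the number of groups with entry $j$. Reading word: buoy entries only, columns left to right, each column bottom to top. For $i\in\{1,\dots,n-1\}$, write $+$ for each letter $i$, $-$ for each $i+1$, cancel pairs $-+$ successively until $+\cdots+-\cdots-$ remains. $e_iT$: $0$ if no uncanceled $-$; else let $\mathsf g$ be the group of the leftmost uncanceled $-$; if the entry immediately above the anchor of $\mathsf g$ is $i$, move the divider between $\mathsf g$ and the group immediately to its left one step up (remove it and insert a divider at the same horizontal position in the row above); otherwise change every $i+1$ of $\mathsf g$ to $i$. $T$ is highest weight if $e_iT=0$ for all $i$. -}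

module Defs where

open import Data.Nat using (ℕ; zero; suc; _≤_; _<_; _∸_; _+_; _≡ᵇ_; _≤ᵇ_; _<ᵇ_)
open import Data.Bool using (Bool; true; false; _∧_; not; if_then_else_; T)
open import Data.List.Base using (List; []; _∷_; length; map; upTo; concatMap; reverse)
open import Data.List.Relation.Unary.All using (All)
open import Data.List.Relation.Unary.Linked using (Linked)
open import Data.Maybe using (Maybe; just; nothing)
open import Data.Product using (_×_; _,_; Σ)
open import Function.Bundles using (_↔_)

-- Generic helpers (all indices are 0-based)

nth : {A : Set} → List A → ℕ → Maybe A
nth []       _       = nothing
nth (x ∷ _)  zero    = just x
nth (_ ∷ xs) (suc j) = nth xs j

all : {A : Set} → (A → Bool) → List A → Bool
all p []       = true
all p (x ∷ xs) = p x ∧ all p xs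

allBelow : ℕ → (ℕ → Bool) → Bool
allBelow m f = all f (upTo m)

-- i-th part λ_{i+1} (0-based index i), 0 beyond the length
part : List ℕ → ℕ → ℕ
part []       _       = 0
part (x ∷ _)  zero    = x
part (_ ∷ xs) (suc i) = part xs i

IsPartition : List ℕ → Set
IsPartition λ' = Linked (λ a b → b ≤ a) λ' × All (λ a → 0 < a) λ'

_⊆ₚ_ : List ℕ → List ℕ → Set
μ ⊆ₚ λ' = ∀ i → part μ i ≤ part λ' i

ℓ : List ℕ → ℕ
ℓ = length

-- A candidate is a list of rows; each box is (entry , isBuoy), where
-- isBuoy = true iff the box is the leftmost box of its group, i.e. there
-- is a divider immediately to its left (or it is the first box of its row).

Box : Set
Box = ℕ × Bool

entryAt : List (List Box) → ℕ → ℕ → Maybe Box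
entryAt T i j with nth T i
... | nothing = nothing
... | just r  = nth r j

rowLen : List (List Box) → ℕ → ℕ
rowLen T i with nth T i
... | nothing = 0
... | just r  = length r

groupsOK-from : ℕ → List Box → Bool
groupsOK-from a []              = true
groupsOK-from a ((b , β) ∷ bs)  = (β ∧ groupsOK-from b bs) ∨' ((not β) ∧ (a ≡ᵇ b) ∧ groupsOK-from b bs)
  where
  _∨'_ : Bool → Bool → Bool
  true  ∨' _ = true
  false ∨' y = y

groupsOK : List Box → Bool
groupsOK []             = true
groupsOK ((b , β) ∷ bs) = β ∧ groupsOK-from b bs

isVST : ℕ → List ℕ → List (List Box) → Bool
isVST n λ' T =
  (length T ≡ᵇ length λ')
  ∧ allBelow (length λ') (λ i → rowLen T i ≡ᵇ part λ' i)
  ∧ allBelow (length λ') (λ i → allBelow (part λ' 0) (λ j → cellOK i j))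
  ∧ all groupsOK T
  where
  cellOK : ℕ → ℕ → Bool
  cellOK i j with entryAt T i j
  ... | nothing      = true
  ... | just (a , _) =
        (1 ≤ᵇ a) ∧ (a ≤ᵇ n)
        ∧ right ∧ down
    where
    right : Bool
    right with entryAt T i (suc j)
    ... | nothing      = true
    ... | just (b , _) = a ≤ᵇ b
    down : Bool
    down with entryAt T (suc i) j
    ... | nothing      = true
    ... | just (b , _) = a <ᵇ b

groupsWith : ℕ → List (List Box) → ℕ
groupsWith j []              = 0
groupsWith j ([] ∷ rs)       = groupsWith j rs
groupsWith j ((b ∷ bs) ∷ rs) =
  (if (b .Data.Product.proj₂ ∧ (b .Data.Product.proj₁ ≡ᵇ j)) then 1 else 0)
  + groupsWith j (bs ∷ rs)

-- weight (m_1,…,m_n) equals μ (padded by zeros); entries are ≤ n anyway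
hasWeight : ℕ → List ℕ → List (List Box) → Bool
hasWeight n μ T = allBelow n (λ k → groupsWith (suc k) T ≡ᵇ part μ k)

readingWord : List (List Box) → List ℕ
readingWord T =
  concatMap (λ j → concatMap (λ i → buoyAt i j) (reverse (upTo (length T))))
            (upTo (rowLen T 0))
  where
  buoyAt : ℕ → ℕ → List ℕ
  buoyAt i j with entryAt T i j
  ... | nothing            = []
  ... | just (a , false)   = []
  ... | just (a , true)    = a ∷ []

-- bracketing for the letter i: i ↦ +, i+1 ↦ −; successively cancel
-- pairs "−+". Scanning left to right, k counts the − not yet cancelled;
-- the result is the number of uncancelled − in  +⋯+−⋯− .
uncancelledMinus-from : ℕ → ℕ → List ℕ → ℕ
uncancelledMinus-from i k []       = k
uncancelledMinus-from i k (x ∷ xs) =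
  if x ≡ᵇ suc i then uncancelledMinus-from i (suc k) xs
  else if x ≡ᵇ i then uncancelledMinus-from i (k ∸ 1) xs
  else uncancelledMinus-from i k xs

uncancelledMinus : ℕ → List ℕ → ℕ
uncancelledMinus i w = uncancelledMinus-from i 0 w

eᵢ≡0 : ℕ → List (List Box) → Bool
eᵢ≡0 i T = uncancelledMinus i (readingWord T) ≡ᵇ 0

isHighestWeight : ℕ → List (List Box) → Bool
isHighestWeight n T = allBelow (n ∸ 1) (λ k → eᵢ≡0 (suc k) T)

HWVST : ℕ → List ℕ → List ℕ → Set
HWVST n λ' μ =
  Σ (List (List Box)) λ τ →
    T (isVST n λ' τ ∧ hasWeight n μ τ ∧ isHighestWeight n τ)

-- Reverse plane partitions of shape λ/μ.
-- P is a list of rows; row i lists the entries of the boxes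
-- (i, μ_i), …, (i, λ_i - 1) of λ/μ from left to right.

rppAt : List ℕ → List (List ℕ) → ℕ → ℕ → Maybe ℕ
rppAt μ P i c with nth P i
... | nothing = nothing
... | just r  = if c <ᵇ part μ i then nothing else nth r (c ∸ part μ i)

isBoundedRPP : List ℕ → List ℕ → List (List ℕ) → Bool
isBoundedRPP λ' μ P =
  (length P ≡ᵇ length λ')
  ∧ allBelow (length λ') (λ i → rowLenP i ≡ᵇ (part λ' i ∸ part μ i))
  ∧ allBelow (length λ') (λ i → allBelow (part λ' 0) (λ c → cellOK i c))
  where
  rowLenP : ℕ → ℕ
  rowLenP i with nth P i
  ... | nothing = 0
  ... | just r  = length r
  cellOK : ℕ → ℕ → Bool
  cellOK i c with rppAt μ P i c
  ... | nothing = true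
  ... | just a  =
        (1 ≤ᵇ a)
        ∧ ((part μ 0 + 1 ∸ part μ i) ≤ᵇ a) ∧ (a ≤ᵇ part μ 0)
        ∧ right ∧ down
    where
    right : Bool
    right with rppAt μ P i (suc c)
    ... | nothing = true
    ... | just b  = a ≤ᵇ b
    down : Bool
    down with rppAt μ P (suc i) c
    ... | nothing = true
    ... | just b  = a ≤ᵇ b

BoundedRPP : List ℕ → List ℕ → Set
BoundedRPP λ' μ = Σ (List (List ℕ)) λ P → T (isBoundedRPP λ' μ P)

-- In a highest weight valued-set tableau every box of row i carries i+1:
-- a buoy with a larger entry a would be an uncancelled a in the
-- (a−1)-bracketing, since the boxes above it carry smaller letters and
-- the boxes after it in the reading word carry letters ≥ a. Such a
-- tableau is therefore just its pattern of buoys: rows of flags of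
-- lengths λ_i with μ_i buoys each, the first box a buoy, and the
-- bracketing of rows i and i+1 balanced. Replacing every non-buoy box of
-- row i by μ_1 − μ_i plus the number of buoys to its left turns row i into
-- a weakly increasing row of λ_i − μ_i entries in [μ_1 + 1 − μ_i, μ_1],
-- and the balance of rows i and i+1 becomes exactly the column condition
-- between these rows placed from columns μ_i and μ_{i+1} on.

module Submission where

open import Defs
open import Data.Nat using (ℕ; _≤_)
open import Data.List using (List)
open import Function.Bundles using (_↔_)

open import Data.Bool using (Bool; true; false; T; _∧_; if_then_else_)
open import Data.Bool.Properties using (T-∧; T-≡; T-irrelevant)
open import Data.Empty using (⊥; ⊥-elim)
open import Data.List
  using ([]; _∷_; _++_; drop; length; replicate; map; upTo; downFrom; applyUpTo; concatMap; reverse)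
open import Data.List.Properties
  using (length-replicate; length-++; length-map; map-∘; map-id; ++-identityʳ; reverse-applyUpTo;
         concatMap-++; concatMap-cong; upTo-∷ʳ)
open import Data.List.Relation.Unary.All using (All; []; _∷_)
import Data.List.Relation.Unary.All as All
open import Data.List.Relation.Unary.All.Properties using (++⁺; concat⁺; map⁺; applyDownFrom⁺₁)
open import Data.List.Relation.Unary.Linked using (Linked; []; [-]; _∷_)
open import Data.Maybe using (Maybe; just; nothing)
import Data.Maybe as Maybe
open import Data.Maybe.Properties using (just-injective)
open import Data.Nat using (zero; suc; _+_; _∸_; _<_; z≤n; s≤s; _≡ᵇ_; _≤ᵇ_; _<ᵇ_)
open import Data.Nat.Induction using (<-rec)
open import Data.Nat.Properties
open import Data.Product using (Σ; _×_; _,_; proj₁; proj₂)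
open import Data.Sum using (_⊎_; inj₁; inj₂)
open import Data.Unit using (⊤; tt)
open import Function.Base using (_∘_; case_of_)
open import Function.Bundles using (Equivalence; mk↔ₛ′)
open import Relation.Binary.PropositionalEquality
open import Relation.Nullary using (¬_; yes; no)

private
  T-∧⁻ : ∀ {x y} → T (x ∧ y) → T x × T y
  T-∧⁻ = Equivalence.to T-∧

  T-∧⁺ : ∀ {x y} → T x → T y → T (x ∧ y)
  T-∧⁺ p q = Equivalence.from T-∧ (p , q)

all-applyUpTo⁻ : ∀ (f : ℕ → Bool) g m → T (all f (applyUpTo g m)) → ∀ {k} → k < m → T (f (g k))
all-applyUpTo⁻ f g (suc m) p {zero}  _         = proj₁ (T-∧⁻ p)
all-applyUpTo⁻ f g (suc m) p {suc k} (s≤s k<m) = all-applyUpTo⁻ f (g ∘ suc) m (proj₂ (T-∧⁻ p)) k<m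

all-applyUpTo⁺ : ∀ (f : ℕ → Bool) g m → (∀ {k} → k < m → T (f (g k))) → T (all f (applyUpTo g m))
all-applyUpTo⁺ f g zero    h = tt
all-applyUpTo⁺ f g (suc m) h = T-∧⁺ (h (s≤s z≤n)) (all-applyUpTo⁺ f (g ∘ suc) m (h ∘ s≤s))

allBelow⁻ : ∀ m f → T (allBelow m f) → ∀ {k} → k < m → T (f k)
allBelow⁻ m f = all-applyUpTo⁻ f (λ k → k) m

allBelow⁺ : ∀ m f → (∀ {k} → k < m → T (f k)) → T (allBelow m f)
allBelow⁺ m f = all-applyUpTo⁺ f (λ k → k) m

all-nth⁻ : ∀ {A : Set} (p : A → Bool) xs → T (all p xs) → ∀ i {x} → nth xs i ≡ just x → T (p x)
all-nth⁻ p (y ∷ xs) h zero    refl = proj₁ (T-∧⁻ h)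
all-nth⁻ p (y ∷ xs) h (suc i) e    = all-nth⁻ p xs (proj₂ (T-∧⁻ h)) i e

≡ᵇ-true : ∀ {m n} → (m ≡ᵇ n) ≡ true → m ≡ n
≡ᵇ-true {m} {n} e = ≡ᵇ⇒≡ m n (subst T (sym e) tt)

≡ᵇ-refl : ∀ n → (n ≡ᵇ n) ≡ true
≡ᵇ-refl zero    = refl
≡ᵇ-refl (suc n) = ≡ᵇ-refl n

nth-just⇒< : ∀ {A : Set} (xs : List A) i {x} → nth xs i ≡ just x → i < length xs
nth-just⇒< (y ∷ xs) zero    e = s≤s z≤n
nth-just⇒< (y ∷ xs) (suc i) e = s≤s (nth-just⇒< xs i e)

<⇒nth-just : ∀ {A : Set} (xs : List A) i → i < length xs → Σ A λ x → nth xs i ≡ just x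
<⇒nth-just (x ∷ xs) zero    _       = x , refl
<⇒nth-just (x ∷ xs) (suc i) (s≤s p) = <⇒nth-just xs i p

≥⇒nth-nothing : ∀ {A : Set} (xs : List A) i → length xs ≤ i → nth xs i ≡ nothing
≥⇒nth-nothing []       i       _       = refl
≥⇒nth-nothing (x ∷ xs) (suc i) (s≤s p) = ≥⇒nth-nothing xs i p

nth-map : ∀ {A B : Set} (f : A → B) xs i → nth (map f xs) i ≡ Maybe.map f (nth xs i)
nth-map f []       i       = refl
nth-map f (x ∷ xs) zero    = refl
nth-map f (x ∷ xs) (suc i) = nth-map f xs i

row : {A : Set} → List (List A) → ℕ → List A
row xs i = Maybe.fromMaybe [] (nth xs i)

row-nth : ∀ {A : Set} (xs : List (List A)) i {r} → nth xs i ≡ just r → row xs i ≡ r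
row-nth xs i e = cong (Maybe.fromMaybe []) e

row-≥ : ∀ {A : Set} (xs : List (List A)) i → length xs ≤ i → row xs i ≡ []
row-≥ xs i p = cong (Maybe.fromMaybe []) (≥⇒nth-nothing xs i p)

row-map : ∀ {A B : Set} (f : A → B) (xs : List (List A)) i → row (map (map f) xs) i ≡ map f (row xs i)
row-map f []       i       = refl
row-map f (x ∷ xs) zero    = refl
row-map f (x ∷ xs) (suc i) = row-map f xs i

entryAt-row : ∀ τ i j → entryAt τ i j ≡ nth (row τ i) j
entryAt-row τ i j with nth τ i
... | nothing = refl
... | just r  = refl

rowLen-row : ∀ τ i → rowLen τ i ≡ length (row τ i)
rowLen-row τ i with nth τ i
... | nothing = refl
... | just r  = refl

Antitone : List ℕ → Set
Antitone = Linked (λ a b → b ≤ a)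

part-suc-≤ : ∀ {ps} → Antitone ps → ∀ i → part ps (suc i) ≤ part ps i
part-suc-≤ []       i       = z≤n
part-suc-≤ [-]      i       = z≤n
part-suc-≤ (p ∷ _)  zero    = p
part-suc-≤ (_ ∷ ps) (suc i) = part-suc-≤ ps i

part-antitone : ∀ {ps} → Antitone ps → ∀ {i i′} → i ≤ i′ → part ps i′ ≤ part ps i
part-antitone {ps} a {i} i≤i′ = subst (λ k → part ps k ≤ part ps i) (m∸n+n≡m i≤i′) (go (_ ∸ i))
  where
  go : ∀ d → part ps (d + i) ≤ part ps i
  go zero    = ≤-refl
  go (suc d) = ≤-trans (part-suc-≤ a (d + i)) (go d)

part-≤-head : ∀ {ps} → Antitone ps → ∀ i → part ps i ≤ part ps 0
part-≤-head a i = part-antitone a z≤n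

part-positive : ∀ {ps} → All (0 <_) ps → ∀ {i} → i < length ps → 0 < part ps i
part-positive (p ∷ _)  {zero}  _       = p
part-positive (_ ∷ ps) {suc i} (s≤s q) = part-positive ps q

part-≥ : ∀ ps i → length ps ≤ i → part ps i ≡ 0
part-≥ []       i       _       = refl
part-≥ (x ∷ ps) (suc i) (s≤s p) = part-≥ ps i p

-- Rows i and i+1 of λ/μ start in columns μ₀ ≥ μ₁ and end before λ₀ ≥ λ₁:
-- the box of row i+1 at offset (μ₀ − μ₁) + j has a box of row i at offset j above it.
skew-index-above : ∀ {λ₀ λ₁ μ₀ μ₁ j} → λ₁ ≤ λ₀ → μ₁ ≤ μ₀ → μ₁ ≤ λ₁ →
                   (μ₀ ∸ μ₁) + j < λ₁ ∸ μ₁ → j < λ₀ ∸ μ₀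
skew-index-above {λ₀} {λ₁} {μ₀} {μ₁} {j} λ₁≤λ₀ μ₁≤μ₀ μ₁≤λ₁ below =
  m+n≤o⇒m≤o∸n (suc j) (begin
    suc j + μ₀                     ≡⟨ cong (λ k → suc j + k) (sym (m∸n+n≡m μ₁≤μ₀)) ⟩
    suc j + ((μ₀ ∸ μ₁) + μ₁)       ≡⟨ cong suc (sym (+-assoc j (μ₀ ∸ μ₁) μ₁)) ⟩
    suc (j + (μ₀ ∸ μ₁)) + μ₁       ≡⟨ cong (λ k → suc k + μ₁) (+-comm j (μ₀ ∸ μ₁)) ⟩
    suc ((μ₀ ∸ μ₁) + j) + μ₁       ≤⟨ m≤o∸n⇒m+n≤o (suc ((μ₀ ∸ μ₁) + j)) μ₁≤λ₁ below ⟩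
    λ₁                             ≤⟨ λ₁≤λ₀ ⟩
    λ₀                             ∎)
  where open ≤-Reasoning

buoys : List Bool → ℕ
buoys []           = 0
buoys (true  ∷ xs) = suc (buoys xs)
buoys (false ∷ xs) = buoys xs

seeMinus : Bool → ℕ → ℕ
seeMinus true  k = suc k
seeMinus false k = k

seePlus : Bool → ℕ → ℕ
seePlus true  k = k ∸ 1
seePlus false k = k

-- The bracketing of the letters i, i+1 of two consecutive constant rows,
-- read column by column: a buoy of the lower row b is a −, then a buoy of
-- the upper row a is a + which cancels a pending −.
pairScan : ℕ → List Bool → List Bool → ℕ
pairScan k []       []       = k
pairScan k []       (y ∷ ys) = pairScan (seeMinus y k) [] ys
pairScan k (x ∷ xs) []       = pairScan (seePlus x k) xs []
pairScan k (x ∷ xs) (y ∷ ys) = pairScan (seePlus x (seeMinus y k)) xs ys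

-- s is the surplus of buoys of a over those of b in the columns not yet
-- read; it must stay nonnegative.
Dominates : ℕ → List Bool → List Bool → Set
Dominates s       []           _            = ⊤
Dominates s       (_     ∷ a)  []           = ⊤
Dominates s       (true  ∷ a)  (true  ∷ b)  = Dominates s a b
Dominates zero    (true  ∷ a)  (false ∷ b)  = ⊥
Dominates (suc s) (true  ∷ a)  (false ∷ b)  = Dominates s a b
Dominates s       (false ∷ a)  (true  ∷ b)  = Dominates (suc s) a b
Dominates s       (false ∷ a)  (false ∷ b)  = Dominates s a b

pairScan-[]ʳ≡0⇒≤ : ∀ k a → pairScan k a [] ≡ 0 → k ≤ buoys a
pairScan-[]ʳ≡0⇒≤ k       []          e = ≤-reflexive e
pairScan-[]ʳ≡0⇒≤ zero    (true  ∷ a) e = z≤n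
pairScan-[]ʳ≡0⇒≤ (suc k) (true  ∷ a) e = s≤s (pairScan-[]ʳ≡0⇒≤ k a e)
pairScan-[]ʳ≡0⇒≤ k       (false ∷ a) e = pairScan-[]ʳ≡0⇒≤ k a e

≤⇒pairScan-[]ʳ≡0 : ∀ k a → k ≤ buoys a → pairScan k a [] ≡ 0
≤⇒pairScan-[]ʳ≡0 zero    []          _       = refl
≤⇒pairScan-[]ʳ≡0 zero    (true  ∷ a) _       = ≤⇒pairScan-[]ʳ≡0 0 a z≤n
≤⇒pairScan-[]ʳ≡0 (suc k) (true  ∷ a) (s≤s p) = ≤⇒pairScan-[]ʳ≡0 k a p
≤⇒pairScan-[]ʳ≡0 k       (false ∷ a) p       = ≤⇒pairScan-[]ʳ≡0 k a p

pairScan-[]ˡ≡0⇒≡0 : ∀ k b → pairScan k [] b ≡ 0 → k + buoys b ≡ 0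
pairScan-[]ˡ≡0⇒≡0 k []          e = trans (+-identityʳ k) e
pairScan-[]ˡ≡0⇒≡0 k (true  ∷ b) e = trans (+-suc k (buoys b)) (pairScan-[]ˡ≡0⇒≡0 (suc k) b e)
pairScan-[]ˡ≡0⇒≡0 k (false ∷ b) e = pairScan-[]ˡ≡0⇒≡0 k b e

≡0⇒pairScan-[]ˡ≡0 : ∀ k b → k + buoys b ≡ 0 → pairScan k [] b ≡ 0
≡0⇒pairScan-[]ˡ≡0 zero []          _ = refl
≡0⇒pairScan-[]ˡ≡0 k    (true  ∷ b) e = ≡0⇒pairScan-[]ˡ≡0 (suc k) b (trans (sym (+-suc k (buoys b))) e)
≡0⇒pairScan-[]ˡ≡0 k    (false ∷ b) e = ≡0⇒pairScan-[]ˡ≡0 k b e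

private
  ∸1+≤⇒+≤suc : ∀ k {m n} → k ∸ 1 + m ≤ n → k + m ≤ suc n
  ∸1+≤⇒+≤suc zero    p = m≤n⇒m≤1+n p
  ∸1+≤⇒+≤suc (suc k) p = s≤s p

  +≤suc⇒∸1+≤ : ∀ k {m n} → m ≤ n → k + m ≤ suc n → k ∸ 1 + m ≤ n
  +≤suc⇒∸1+≤ zero    m≤n _       = m≤n
  +≤suc⇒∸1+≤ (suc k) _   (s≤s p) = p

pairScan≡0⇒dominates : ∀ k a b → pairScan k a b ≡ 0 →
                       k + buoys b ≤ buoys a × Dominates (buoys a ∸ buoys b) a b
pairScan≡0⇒dominates k [] b e = ≤-reflexive (pairScan-[]ˡ≡0⇒≡0 k b e) , tt
pairScan≡0⇒dominates k (x ∷ a) [] e =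
  subst (_≤ buoys (x ∷ a)) (sym (+-identityʳ k)) (pairScan-[]ʳ≡0⇒≤ k (x ∷ a) e) , tt
pairScan≡0⇒dominates k (true ∷ a) (true ∷ b) e
  with p , q ← pairScan≡0⇒dominates k a b e =
  subst (_≤ suc (buoys a)) (sym (+-suc k (buoys b))) (s≤s p) , q
pairScan≡0⇒dominates k (true ∷ a) (false ∷ b) e
  with p , q ← pairScan≡0⇒dominates (k ∸ 1) a b e
  rewrite +-∸-assoc 1 (≤-trans (m≤n+m (buoys b) (k ∸ 1)) p) =
  ∸1+≤⇒+≤suc k p , q
pairScan≡0⇒dominates k (false ∷ a) (true ∷ b) e
  with p , q ← pairScan≡0⇒dominates (suc k) a b e =
  subst (_≤ buoys a) (sym (+-suc k (buoys b))) p ,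
  subst (λ s → Dominates s a b) (+-∸-assoc 1 (≤-trans (s≤s (m≤n+m (buoys b) k)) p)) q
pairScan≡0⇒dominates k (false ∷ a) (false ∷ b) e = pairScan≡0⇒dominates k a b e

dominates⇒pairScan≡0 : ∀ k a b → k + buoys b ≤ buoys a → Dominates (buoys a ∸ buoys b) a b →
                       pairScan k a b ≡ 0
dominates⇒pairScan≡0 k [] b p _ = ≡0⇒pairScan-[]ˡ≡0 k b (n≤0⇒n≡0 p)
dominates⇒pairScan≡0 k (x ∷ a) [] p _ =
  ≤⇒pairScan-[]ʳ≡0 k (x ∷ a) (subst (_≤ buoys (x ∷ a)) (+-identityʳ k) p)
dominates⇒pairScan≡0 k (true ∷ a) (true ∷ b) p q =
  dominates⇒pairScan≡0 k a b (≤-pred (subst (_≤ suc (buoys a)) (+-suc k (buoys b)) p)) q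
dominates⇒pairScan≡0 k (true ∷ a) (false ∷ b) p q with buoys b ≤? buoys a
... | yes b≤a = dominates⇒pairScan≡0 (k ∸ 1) a b (+≤suc⇒∸1+≤ k b≤a p)
                  (subst (λ s → Dominates s (true ∷ a) (false ∷ b)) (+-∸-assoc 1 b≤a) q)
... | no b≰a  = ⊥-elim (subst (λ s → Dominates s (true ∷ a) (false ∷ b))
                               (m≤n⇒m∸n≡0 (≰⇒> b≰a)) q)
dominates⇒pairScan≡0 k (false ∷ a) (true ∷ b) p q =
  dominates⇒pairScan≡0 (suc k) a b p′
    (subst (λ s → Dominates s a b) (sym (+-∸-assoc 1 (≤-trans (s≤s (m≤n+m (buoys b) k)) p′))) q)
  where
  p′ : suc k + buoys b ≤ buoys a
  p′ = subst (_≤ buoys a) (+-suc k (buoys b)) p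
dominates⇒pairScan≡0 k (false ∷ a) (false ∷ b) p q = dominates⇒pairScan≡0 k a b p q

encodeRow : ℕ → List Bool → List ℕ
encodeRow t []           = []
encodeRow t (true  ∷ xs) = encodeRow (suc t) xs
encodeRow t (false ∷ xs) = t ∷ encodeRow t xs

ColumnWeak : ℕ → List ℕ → List ℕ → Set
ColumnWeak s xs ys = ∀ j v → nth ys (s + j) ≡ just v → Σ ℕ λ u → nth xs j ≡ just u × u ≤ v

encodeRow-≥ : ∀ t a j {v} → nth (encodeRow t a) j ≡ just v → t ≤ v
encodeRow-≥ t (true  ∷ a) j       e    = ≤-trans (n≤1+n t) (encodeRow-≥ (suc t) a j e)
encodeRow-≥ t (false ∷ a) zero    refl = ≤-refl
encodeRow-≥ t (false ∷ a) (suc j) e    = encodeRow-≥ t a j e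

encodeRow-≤ : ∀ t a j {v} → nth (encodeRow t a) j ≡ just v → v ≤ t + buoys a
encodeRow-≤ t (true  ∷ a) j {v} e =
  subst (v ≤_) (sym (+-suc t (buoys a))) (encodeRow-≤ (suc t) a j e)
encodeRow-≤ t (false ∷ a) zero    refl = m≤m+n t (buoys a)
encodeRow-≤ t (false ∷ a) (suc j) e    = encodeRow-≤ t a j e

encodeRow-sorted : ∀ t a j {u v} → nth (encodeRow t a) j ≡ just u →
                   nth (encodeRow t a) (suc j) ≡ just v → u ≤ v
encodeRow-sorted t (true  ∷ a) j       e e′ = encodeRow-sorted (suc t) a j e e′
encodeRow-sorted t (false ∷ a) zero    refl e′ = encodeRow-≥ t a 0 e′
encodeRow-sorted t (false ∷ a) (suc j) e e′ = encodeRow-sorted t a j e e′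

length-encodeRow : ∀ t a → length (encodeRow t a) + buoys a ≡ length a
length-encodeRow t []          = refl
length-encodeRow t (true  ∷ a) = trans (+-suc _ (buoys a)) (cong suc (length-encodeRow (suc t) a))
length-encodeRow t (false ∷ a) = cong suc (length-encodeRow t a)

dominates⇒columnWeak : ∀ ta a tb b s → ta + s ≡ tb → length b ≤ length a → Dominates s a b →
                       ColumnWeak s (encodeRow ta a) (encodeRow tb b)
dominates⇒columnWeak ta a tb [] s _ _ _ j v ()
dominates⇒columnWeak ta (true ∷ a) tb (true ∷ b) s eq (s≤s len) d =
  dominates⇒columnWeak (suc ta) a (suc tb) b s (cong suc eq) len d
dominates⇒columnWeak ta (true ∷ a) tb (false ∷ b) (suc s) eq (s≤s len) d =
  dominates⇒columnWeak (suc ta) a tb b s (trans (sym (+-suc ta s)) eq) len d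
dominates⇒columnWeak ta (false ∷ a) tb (y ∷ b) s eq len d zero v e =
  ta , refl , ≤-trans (subst (ta ≤_) eq (m≤m+n ta s)) (encodeRow-≥ tb (y ∷ b) (s + 0) e)
dominates⇒columnWeak ta (false ∷ a) tb (true ∷ b) s eq (s≤s len) d (suc j) v e =
  dominates⇒columnWeak ta a (suc tb) b (suc s) (trans (+-suc ta s) (cong suc eq)) len d j v
    (subst (λ k → nth (encodeRow (suc tb) b) k ≡ just v) (+-suc s j) e)
dominates⇒columnWeak ta (false ∷ a) tb (false ∷ b) s eq (s≤s len) d (suc j) v e =
  dominates⇒columnWeak ta a tb b s eq len d j v
    (subst (λ k → nth (tb ∷ encodeRow tb b) k ≡ just v) (+-suc s j) e)

columnWeak⇒dominates : ∀ ta a tb b s → ta + s ≡ tb →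
                       ColumnWeak s (encodeRow ta a) (encodeRow tb b) → Dominates s a b
columnWeak⇒dominates ta [] tb b s _ _ = tt
columnWeak⇒dominates ta (x ∷ a) tb [] s _ _ = tt
columnWeak⇒dominates ta (true ∷ a) tb (true ∷ b) s eq w =
  columnWeak⇒dominates (suc ta) a (suc tb) b s (cong suc eq) w
columnWeak⇒dominates ta (true ∷ a) tb (false ∷ b) zero eq w
  with u , e , u≤tb ← w 0 tb refl =
  ⊥-elim (<⇒≱ (subst (_< u) (trans (sym (+-identityʳ ta)) eq) (encodeRow-≥ (suc ta) a 0 e)) u≤tb)
columnWeak⇒dominates ta (true ∷ a) tb (false ∷ b) (suc s) eq w =
  columnWeak⇒dominates (suc ta) a tb b s (trans (sym (+-suc ta s)) eq) w
columnWeak⇒dominates ta (false ∷ a) tb (true ∷ b) s eq w =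
  columnWeak⇒dominates ta a (suc tb) b (suc s) (trans (+-suc ta s) (cong suc eq))
    (λ j v e → w (suc j) v (subst (λ k → nth (encodeRow (suc tb) b) k ≡ just v) (sym (+-suc s j)) e))
columnWeak⇒dominates ta (false ∷ a) tb (false ∷ b) s eq w =
  columnWeak⇒dominates ta a tb b s eq
    (λ j v e → w (suc j) v (subst (λ k → nth (tb ∷ encodeRow tb b) k ≡ just v) (sym (+-suc s j)) e))

-- Inverse of encodeRow p on rows with m − p buoys: the entries step up by
-- one per buoy, and the final buoys raise the level from the last entry to m.
decodeRow : ℕ → ℕ → List ℕ → List Bool
decodeRow m p []       = replicate (m ∸ p) true
decodeRow m p (g ∷ gs) = replicate (g ∸ p) true ++ false ∷ decodeRow m g gs

data SortedWithin (m : ℕ) : ℕ → List ℕ → Set where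
  []  : ∀ {p} → p ≤ m → SortedWithin m p []
  _∷_ : ∀ {p g gs} → p ≤ g → SortedWithin m g gs → SortedWithin m p (g ∷ gs)

SortedWithin-≤ : ∀ {m p gs} → SortedWithin m p gs → p ≤ m
SortedWithin-≤ ([] p≤m)   = p≤m
SortedWithin-≤ (p≤g ∷ s) = ≤-trans p≤g (SortedWithin-≤ s)

sortedWithin : ∀ m p gs → p ≤ m → (∀ j {u} → nth gs j ≡ just u → u ≤ m) →
               (∀ {u} → nth gs 0 ≡ just u → p ≤ u) →
               (∀ j {u v} → nth gs j ≡ just u → nth gs (suc j) ≡ just v → u ≤ v) →
               SortedWithin m p gs
sortedWithin m p []       p≤m _   _     _      = [] p≤m
sortedWithin m p (g ∷ gs) p≤m ≤m p≤hd sorted =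
  p≤hd refl ∷ sortedWithin m g gs (≤m 0 refl) (≤m ∘ suc) (sorted 0 refl) (sorted ∘ suc)

private
  replicate-suc-++ : ∀ {A : Set} n (x : A) ys → replicate (suc n) x ++ ys ≡ replicate n x ++ x ∷ ys
  replicate-suc-++ zero    x ys = refl
  replicate-suc-++ (suc n) x ys = cong (x ∷_) (replicate-suc-++ n x ys)

  telescope-∸ : ∀ {m g p} → g ≤ m → p ≤ g → (m ∸ g) + (g ∸ p) ≡ m ∸ p
  telescope-∸ {m} {g} {p} g≤m p≤g = trans (sym (+-∸-assoc (m ∸ g) p≤g)) (cong (_∸ p) (m∸n+n≡m g≤m))

encodeRow-replicate++ : ∀ t r xs → encodeRow t (replicate r true ++ xs) ≡ encodeRow (r + t) xs
encodeRow-replicate++ t zero    xs = refl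
encodeRow-replicate++ t (suc r) xs =
  trans (encodeRow-replicate++ (suc t) r xs) (cong (λ u → encodeRow u xs) (+-suc r t))

buoys-replicate++ : ∀ r xs → buoys (replicate r true ++ xs) ≡ r + buoys xs
buoys-replicate++ zero    xs = refl
buoys-replicate++ (suc r) xs = cong suc (buoys-replicate++ r xs)

decodeRow-encodeRow  : ∀ m q a → q + buoys a ≡ m → decodeRow m q (encodeRow q a) ≡ a
decodeRow-encodeRow′ : ∀ m p q a → q + buoys a ≡ m → p ≤ q →
                       decodeRow m p (encodeRow q a) ≡ replicate (q ∸ p) true ++ a

decodeRow-encodeRow m q a e =
  trans (decodeRow-encodeRow′ m q q a e ≤-refl) (cong (λ k → replicate k true ++ a) (n∸n≡0 q))

decodeRow-encodeRow′ m p q [] e p≤q =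
  trans (cong (λ k → replicate (k ∸ p) true) (trans (sym e) (+-identityʳ q)))
        (sym (++-identityʳ _))
decodeRow-encodeRow′ m p q (true ∷ a) e p≤q =
  trans (decodeRow-encodeRow′ m p (suc q) a (trans (sym (+-suc q (buoys a))) e) (m≤n⇒m≤1+n p≤q))
        (trans (cong (λ k → replicate k true ++ a) (+-∸-assoc 1 p≤q))
               (replicate-suc-++ (q ∸ p) true a))
decodeRow-encodeRow′ m p q (false ∷ a) e p≤q =
  cong (λ xs → replicate (q ∸ p) true ++ false ∷ xs) (decodeRow-encodeRow m q a e)

encodeRow-decodeRow : ∀ m p gs → SortedWithin m p gs → encodeRow p (decodeRow m p gs) ≡ gs
encodeRow-decodeRow m p [] _ =
  trans (cong (encodeRow p) (sym (++-identityʳ (replicate (m ∸ p) true))))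
        (encodeRow-replicate++ p (m ∸ p) [])
encodeRow-decodeRow m p (g ∷ gs) (p≤g ∷ s) =
  trans (encodeRow-replicate++ p (g ∸ p) (false ∷ decodeRow m g gs))
        (cong₂ (λ k xs → k ∷ xs) (m∸n+n≡m p≤g)
               (trans (cong (λ k → encodeRow k (decodeRow m g gs)) (m∸n+n≡m p≤g))
                      (encodeRow-decodeRow m g gs s)))

buoys-decodeRow : ∀ m p gs → SortedWithin m p gs → buoys (decodeRow m p gs) ≡ m ∸ p
buoys-decodeRow m p [] _ =
  trans (cong buoys (sym (++-identityʳ (replicate (m ∸ p) true))))
        (trans (buoys-replicate++ (m ∸ p) []) (+-identityʳ _))
buoys-decodeRow m p (g ∷ gs) (p≤g ∷ s) = begin
  buoys (replicate (g ∸ p) true ++ false ∷ decodeRow m g gs) ≡⟨ buoys-replicate++ (g ∸ p) _ ⟩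
  (g ∸ p) + buoys (decodeRow m g gs)                          ≡⟨ cong (g ∸ p +_) (buoys-decodeRow m g gs s) ⟩
  (g ∸ p) + (m ∸ g)                                           ≡⟨ +-comm (g ∸ p) (m ∸ g) ⟩
  (m ∸ g) + (g ∸ p)                                           ≡⟨ telescope-∸ (SortedWithin-≤ s) p≤g ⟩
  m ∸ p                                                       ∎
  where open ≡-Reasoning

length-decodeRow : ∀ m p gs → SortedWithin m p gs → length (decodeRow m p gs) ≡ length gs + (m ∸ p)
length-decodeRow m p [] _ = length-replicate (m ∸ p)
length-decodeRow m p (g ∷ gs) (p≤g ∷ s) = begin
  length (replicate (g ∸ p) true ++ false ∷ decodeRow m g gs) ≡⟨ length-++ (replicate (g ∸ p) true) ⟩
  length (replicate (g ∸ p) true) + suc (length (decodeRow m g gs))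
    ≡⟨ cong₂ (λ r d → r + suc d) (length-replicate (g ∸ p)) (length-decodeRow m g gs s) ⟩
  (g ∸ p) + suc (length gs + (m ∸ g)) ≡⟨ +-suc (g ∸ p) _ ⟩
  suc ((g ∸ p) + (length gs + (m ∸ g))) ≡⟨ cong suc (+-comm (g ∸ p) _) ⟩
  suc ((length gs + (m ∸ g)) + (g ∸ p)) ≡⟨ cong suc (+-assoc (length gs) (m ∸ g) (g ∸ p)) ⟩
  suc (length gs + ((m ∸ g) + (g ∸ p)))
    ≡⟨ cong (λ k → suc (length gs + k)) (telescope-∸ (SortedWithin-≤ s) p≤g) ⟩
  suc (length gs + (m ∸ p)) ∎
  where open ≡-Reasoning

HeadBuoy : List Bool → Set
HeadBuoy (true ∷ _) = ⊤
HeadBuoy _          = ⊥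

headBuoy-decodeRow : ∀ m p gs → (gs ≡ [] → p < m) → (∀ {g} → nth gs 0 ≡ just g → p < g) →
                     HeadBuoy (decodeRow m p gs)
headBuoy-decodeRow m p [] p<m _ with m ∸ p in e
... | zero  = ⊥-elim (m>n⇒m∸n≢0 (p<m refl) e)
... | suc _ = tt
headBuoy-decodeRow m p (g ∷ gs) _ p<g with g ∸ p in e
... | zero  = ⊥-elim (m>n⇒m∸n≢0 (p<g refl) e)
... | suc _ = tt

constantRowsFrom : ℕ → List (List Bool) → List (List Box)
constantRowsFrom r []       = []
constantRowsFrom r (f ∷ fs) = map (suc r ,_) f ∷ constantRowsFrom (suc r) fs

constantTableau : List (List Bool) → List (List Box)
constantTableau = constantRowsFrom 0

flags : List (List Box) → List (List Bool)
flags = map (map proj₂)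

length-constantRowsFrom : ∀ r F → length (constantRowsFrom r F) ≡ length F
length-constantRowsFrom r []      = refl
length-constantRowsFrom r (f ∷ F) = cong suc (length-constantRowsFrom (suc r) F)

nth-constantRowsFrom : ∀ r F i → nth (constantRowsFrom r F) i ≡ Maybe.map (map (suc (r + i) ,_)) (nth F i)
nth-constantRowsFrom r []      i       = refl
nth-constantRowsFrom r (f ∷ F) zero    = cong (λ k → just (map (suc k ,_) f)) (sym (+-identityʳ r))
nth-constantRowsFrom r (f ∷ F) (suc i) =
  trans (nth-constantRowsFrom (suc r) F i)
        (cong (λ k → Maybe.map (map (suc k ,_)) (nth F i)) (sym (+-suc r i)))

row-constantTableau : ∀ F i → row (constantTableau F) i ≡ map (suc i ,_) (row F i)
row-constantTableau F i rewrite nth-constantRowsFrom 0 F i with nth F i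
... | nothing = refl
... | just f  = refl

entryAt-constantTableau : ∀ F i j → entryAt (constantTableau F) i j ≡ Maybe.map (suc i ,_) (nth (row F i) j)
entryAt-constantTableau F i j =
  trans (entryAt-row (constantTableau F) i j)
        (trans (cong (λ r → nth r j) (row-constantTableau F i)) (nth-map _ (row F i) j))

rowLen-constantTableau : ∀ F i → rowLen (constantTableau F) i ≡ length (row F i)
rowLen-constantTableau F i =
  trans (rowLen-row (constantTableau F) i)
        (trans (cong length (row-constantTableau F i)) (length-map _ (row F i)))

flags-constantRowsFrom : ∀ r F → flags (constantRowsFrom r F) ≡ F
flags-constantRowsFrom r []      = refl
flags-constantRowsFrom r (f ∷ F) =
  cong₂ _∷_ (trans (sym (map-∘ f)) (map-id f)) (flags-constantRowsFrom (suc r) F)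

constantRowsFrom-flags : ∀ r τ → (∀ i j {a β} → nth (row τ i) j ≡ just (a , β) → a ≡ suc (r + i)) →
                         τ ≡ constantRowsFrom r (flags τ)
constantRowsFrom-flags r []      _ = refl
constantRowsFrom-flags r (x ∷ τ) h =
  cong₂ _∷_ (constantRow x (λ j e → trans (h 0 j e) (cong suc (+-identityʳ r))))
            (constantRowsFrom-flags (suc r) τ (λ i j e → trans (h (suc i) j e) (cong suc (+-suc r i))))
  where
  constantRow : ∀ x → (∀ j {a β} → nth x j ≡ just (a , β) → a ≡ suc r) → x ≡ map (suc r ,_) (map proj₂ x)
  constantRow []            _ = refl
  constantRow ((a , β) ∷ x) h = cong₂ _∷_ (cong (_, β) (h 0 refl)) (constantRow x (h ∘ suc))

buoyLetter : Maybe Box → List ℕ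
buoyLetter nothing             = []
buoyLetter (just (a , false)) = []
buoyLetter (just (a , true))  = a ∷ []

column : List (List Box) → ℕ → List ℕ
column τ j = concatMap (λ i → buoyLetter (entryAt τ i j)) (downFrom (length τ))

-- readingWord uses a local function of Defs, which is only reachable by
-- letting unification name it.
private
  readingWord-local : ∀ τ → Σ (ℕ → ℕ → List ℕ) λ buoyAt → readingWord τ ≡
    concatMap (λ j → concatMap (λ i → buoyAt i j) (reverse (upTo (length τ)))) (upTo (rowLen τ 0))
  readingWord-local τ = _ , refl

  readingWord-local-buoyAt : ∀ τ i j → proj₁ (readingWord-local τ) i j ≡ buoyLetter (entryAt τ i j)
  readingWord-local-buoyAt τ i j with nth τ i
  ... | nothing = refl
  ... | just r with nth r j
  ... | nothing          = refl
  ... | just (a , false) = refl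
  ... | just (a , true)  = refl

readingWord-columns : ∀ τ → readingWord τ ≡ concatMap (column τ) (upTo (rowLen τ 0))
readingWord-columns τ = trans (proj₂ (readingWord-local τ)) (concatMap-cong (λ j →
  trans (cong (concatMap (λ i → proj₁ (readingWord-local τ) i j)) (reverse-applyUpTo (λ i → i) (length τ)))
        (concatMap-cong (λ i → readingWord-local-buoyAt τ i j) (downFrom (length τ)))) (upTo (rowLen τ 0)))

uncancelled-++ : ∀ i k xs ys → uncancelledMinus-from i k (xs ++ ys) ≡
                                uncancelledMinus-from i (uncancelledMinus-from i k xs) ys
uncancelled-++ i k []       ys = refl
uncancelled-++ i k (x ∷ xs) ys with x ≡ᵇ suc i
... | true = uncancelled-++ i (suc k) xs ys
... | false with x ≡ᵇ i
... | true  = uncancelled-++ i (k ∸ 1) xs ys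
... | false = uncancelled-++ i k xs ys

Unrelated : ℕ → ℕ → Set
Unrelated i x = x ≢ i × x ≢ suc i

uncancelled-unrelated : ∀ i k ws → All (Unrelated i) ws → uncancelledMinus-from i k ws ≡ k
uncancelled-unrelated i k []       []             = refl
uncancelled-unrelated i k (x ∷ ws) ((≢i , ≢si) ∷ h) with x ≡ᵇ suc i in e
... | true = ⊥-elim (≢si (≡ᵇ-true e))
... | false with x ≡ᵇ i in e′
... | true  = ⊥-elim (≢i (≡ᵇ-true e′))
... | false = uncancelled-unrelated i k ws h

uncancelled-≥ : ∀ i k ws → All (_≢ i) ws → k ≤ uncancelledMinus-from i k ws
uncancelled-≥ i k []       []         = ≤-refl
uncancelled-≥ i k (x ∷ ws) (≢i ∷ h) with x ≡ᵇ suc i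
... | true = ≤-trans (n≤1+n k) (uncancelled-≥ i (suc k) ws h)
... | false with x ≡ᵇ i in e
... | true  = ⊥-elim (≢i (≡ᵇ-true e))
... | false = uncancelled-≥ i k ws h

-- A word w with an uncancelled i+1, whatever precedes it.
Unbalanced : ℕ → List ℕ → Set
Unbalanced i w = ∀ k → 1 ≤ uncancelledMinus-from i k w

unbalanced-∷ : ∀ i ys → All (_≢ i) ys → Unbalanced i (suc i ∷ ys)
unbalanced-∷ i ys h k rewrite ≡ᵇ-refl (suc i) = ≤-trans (s≤s z≤n) (uncancelled-≥ i (suc k) ys h)

unbalanced-++ʳ : ∀ i xs ys → Unbalanced i xs → All (_≢ i) ys → Unbalanced i (xs ++ ys)
unbalanced-++ʳ i xs ys u h k rewrite uncancelled-++ i k xs ys = ≤-trans (u k) (uncancelled-≥ i _ ys h)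

unbalanced-++ˡ : ∀ i xs ys → Unbalanced i ys → Unbalanced i (xs ++ ys)
unbalanced-++ˡ i xs ys u k rewrite uncancelled-++ i k xs ys = u _

seeMinus? : Maybe Bool → ℕ → ℕ
seeMinus? = Maybe.maybe seeMinus (λ k → k)

seePlus? : Maybe Bool → ℕ → ℕ
seePlus? = Maybe.maybe seePlus (λ k → k)

-- The letter (if any) of row q in a column of a constant tableau, where
-- fl q says whether that box exists and is a buoy.
rowLetter : (ℕ → Maybe Bool) → ℕ → List ℕ
rowLetter fl q = buoyLetter (Maybe.map (suc q ,_) (fl q))

rowLetter-unrelated : ∀ fl k q → Unrelated k q → All (Unrelated (suc k)) (rowLetter fl q)
rowLetter-unrelated fl k q (q≢k , q≢sk) with fl q
... | nothing    = []
... | just false = []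
... | just true  = ((q≢k ∘ suc-injective) , (q≢sk ∘ suc-injective)) ∷ []

uncancelled-rowLetters-unrelated : ∀ fl k c qs → All (Unrelated k) qs →
  uncancelledMinus-from (suc k) c (concatMap (rowLetter fl) qs) ≡ c
uncancelled-rowLetters-unrelated fl k c qs h =
  uncancelled-unrelated (suc k) c _ (concat⁺ (map⁺ (All.map (λ {q} → rowLetter-unrelated fl k q) h)))

uncancelled-rowLetter-plus : ∀ fl k c → uncancelledMinus-from (suc k) c (rowLetter fl k) ≡ seePlus? (fl k) c
uncancelled-rowLetter-plus fl k c with fl k
... | nothing    = refl
... | just false = refl
... | just true rewrite ≡ᵇ-refl k with suc k ≡ᵇ suc (suc k) in e
...   | true  = ⊥-elim (1+n≢n {k} (sym (≡ᵇ-true {k} {suc k} e)))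
...   | false = refl

uncancelled-rowLetter-minus : ∀ fl k c →
  uncancelledMinus-from (suc k) c (rowLetter fl (suc k)) ≡ seeMinus? (fl (suc k)) c
uncancelled-rowLetter-minus fl k c with fl (suc k)
... | nothing    = refl
... | just false = refl
... | just true rewrite ≡ᵇ-refl k = refl

downFrom-split : ∀ r m → downFrom (suc r + m) ≡ map (suc r +_) (downFrom m) ++ r ∷ downFrom r
downFrom-split r zero    = cong downFrom (+-identityʳ (suc r))
downFrom-split r (suc m) = trans (cong downFrom (+-suc (suc r) m)) (cong (suc r + m ∷_) (downFrom-split r m))

rowLetters-pad : ∀ fl N → (∀ q → N ≤ q → fl q ≡ nothing) →
  ∀ d → concatMap (rowLetter fl) (downFrom (d + N)) ≡ concatMap (rowLetter fl) (downFrom N)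
rowLetters-pad fl N out zero    = refl
rowLetters-pad fl N out (suc d) rewrite out (d + N) (m≤n+m N d) = rowLetters-pad fl N out d

-- Only rows k+1 and k carry the letters k+2 and k+1; padding the column
-- with empty rows makes both of them present.
uncancelled-column : ∀ fl N k c → (∀ q → N ≤ q → fl q ≡ nothing) →
  uncancelledMinus-from (suc k) c (concatMap (rowLetter fl) (downFrom N)) ≡
  seePlus? (fl k) (seeMinus? (fl (suc k)) c)
uncancelled-column fl N k c out = begin
  UM c (letters (downFrom N))
    ≡⟨ cong (UM c) (sym (rowLetters-pad fl N out (suc (suc k)))) ⟩
  UM c (letters (downFrom (suc (suc k) + N)))
    ≡⟨ cong (UM c ∘ letters) (downFrom-split (suc k) N) ⟩
  UM c (letters (above ++ suc k ∷ k ∷ downFrom k))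
    ≡⟨ cong (UM c) (concatMap-++ (rowLetter fl) above _) ⟩
  UM c (letters above ++ rowLetter fl (suc k) ++ lower)
    ≡⟨ uncancelled-++ (suc k) c (letters above) _ ⟩
  UM (UM c (letters above)) (rowLetter fl (suc k) ++ lower)
    ≡⟨ cong (λ d → UM d (rowLetter fl (suc k) ++ lower))
            (uncancelled-rowLetters-unrelated fl k c above aboveUnrelated) ⟩
  UM c (rowLetter fl (suc k) ++ lower)
    ≡⟨ uncancelled-++ (suc k) c (rowLetter fl (suc k)) _ ⟩
  UM (UM c (rowLetter fl (suc k))) lower
    ≡⟨ cong (λ d → UM d lower) (uncancelled-rowLetter-minus fl k c) ⟩
  UM c′ lower
    ≡⟨ uncancelled-++ (suc k) c′ (rowLetter fl k) _ ⟩
  UM (UM c′ (rowLetter fl k)) (letters (downFrom k))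
    ≡⟨ uncancelled-rowLetters-unrelated fl k _ (downFrom k) belowUnrelated ⟩
  UM c′ (rowLetter fl k)
    ≡⟨ uncancelled-rowLetter-plus fl k c′ ⟩
  seePlus? (fl k) c′ ∎
  where
  open ≡-Reasoning
  UM = uncancelledMinus-from (suc k)
  letters = concatMap (rowLetter fl)
  above = map (suc (suc k) +_) (downFrom N)
  c′ = seeMinus? (fl (suc k)) c
  lower = rowLetter fl k ++ letters (downFrom k)
  aboveUnrelated : All (Unrelated k) above
  aboveUnrelated = map⁺ (applyDownFrom⁺₁ (λ q → q) N (λ {q} _ →
    (λ e → <-irrefl (sym e) (≤-trans (n≤1+n (suc k)) (m≤m+n (suc (suc k)) q))) ,
    (λ e → <-irrefl (sym e) (m≤m+n (suc (suc k)) q))))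
  belowUnrelated : All (Unrelated k) (downFrom k)
  belowUnrelated = applyDownFrom⁺₁ (λ q → q) k (λ {q} q<k →
    (λ e → <-irrefl e q<k) , (λ e → <-irrefl e (m<n⇒m<1+n q<k)))

uncancelled-column-constantTableau : ∀ F k j c →
  uncancelledMinus-from (suc k) c (column (constantTableau F) j) ≡
  seePlus? (nth (row F k) j) (seeMinus? (nth (row F (suc k)) j) c)
uncancelled-column-constantTableau F k j c =
  trans (cong (uncancelledMinus-from (suc k) c)
              (concatMap-cong (λ i → cong buoyLetter (entryAt-constantTableau F i j)) (downFrom N)))
        (uncancelled-column (λ q → nth (row F q) j) N k c beyond)
  where
  N = length (constantTableau F)
  beyond : ∀ q → N ≤ q → nth (row F q) j ≡ nothing
  beyond q N≤q = cong (λ r → nth r j) (row-≥ F q (subst (_≤ q) (length-constantRowsFrom 0 F) N≤q))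

scanColumns : List Bool → List Bool → List ℕ → ℕ → ℕ
scanColumns a b []       c = c
scanColumns a b (j ∷ js) c = scanColumns a b js (seePlus? (nth a j) (seeMinus? (nth b j) c))

uncancelled-columns-constantTableau : ∀ F k js c →
  uncancelledMinus-from (suc k) c (concatMap (column (constantTableau F)) js) ≡
  scanColumns (row F k) (row F (suc k)) js c
uncancelled-columns-constantTableau F k []       c = refl
uncancelled-columns-constantTableau F k (j ∷ js) c =
  trans (uncancelled-++ (suc k) c (column (constantTableau F) j) _)
        (trans (cong (λ d → uncancelledMinus-from (suc k) d (concatMap (column (constantTableau F)) js))
                     (uncancelled-column-constantTableau F k j c))
               (uncancelled-columns-constantTableau F k js _))

scanColumns-upTo : ∀ W a b c → length a ≤ W → length b ≤ W → scanColumns a b (upTo W) c ≡ pairScan c a b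
scanColumns-upTo zero    [] [] c _ _ = refl
scanColumns-upTo (suc W) a  b  c la lb =
  trans (shift a b (λ j → j) W _)
        (trans (scanColumns-upTo W (drop 1 a) (drop 1 b) _ (length-drop1 a la) (length-drop1 b lb))
               (firstColumn a b))
  where
  nth-suc : ∀ (xs : List Bool) j → nth xs (suc j) ≡ nth (drop 1 xs) j
  nth-suc []       j = refl
  nth-suc (x ∷ xs) j = refl
  shift : ∀ a b f m c → scanColumns a b (applyUpTo (suc ∘ f) m) c ≡
                        scanColumns (drop 1 a) (drop 1 b) (applyUpTo f m) c
  shift a b f zero    c = refl
  shift a b f (suc m) c rewrite nth-suc a (f 0) | nth-suc b (f 0) = shift a b (f ∘ suc) m _
  length-drop1 : ∀ (xs : List Bool) → length xs ≤ suc W → length (drop 1 xs) ≤ W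
  length-drop1 []       _       = z≤n
  length-drop1 (x ∷ xs) (s≤s p) = p
  firstColumn : ∀ a b →
    pairScan (seePlus? (nth a 0) (seeMinus? (nth b 0) c)) (drop 1 a) (drop 1 b) ≡ pairScan c a b
  firstColumn []      []      = refl
  firstColumn []      (y ∷ b) = refl
  firstColumn (x ∷ a) []      = refl
  firstColumn (x ∷ a) (y ∷ b) = refl

uncancelled-constantTableau : ∀ F k →
  length (row F k) ≤ rowLen (constantTableau F) 0 → length (row F (suc k)) ≤ rowLen (constantTableau F) 0 →
  uncancelledMinus (suc k) (readingWord (constantTableau F)) ≡ pairScan 0 (row F k) (row F (suc k))
uncancelled-constantTableau F k la lb =
  trans (cong (uncancelledMinus-from (suc k) 0) (readingWord-columns (constantTableau F)))
        (trans (uncancelled-columns-constantTableau F k (upTo W) 0) (scanColumns-upTo W _ _ 0 la lb))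
  where
  W = rowLen (constantTableau F) 0

groupsWith-constantRow : ∀ j a f rs →
  groupsWith j (map (a ,_) f ∷ rs) ≡ (if a ≡ᵇ j then buoys f else 0) + groupsWith j rs
groupsWith-constantRow j a f rs = go (a ≡ᵇ j) refl f
  where
  go : ∀ b → (a ≡ᵇ j) ≡ b →
       ∀ f → groupsWith j (map (a ,_) f ∷ rs) ≡ (if b then buoys f else 0) + groupsWith j rs
  go true  e []          = refl
  go false e []          = refl
  go true  e (true  ∷ f) rewrite e = cong suc (go true e f)
  go false e (true  ∷ f) rewrite e = go false e f
  go b     e (false ∷ f) = go b e f

private
  ≢⇒≡ᵇ-false : ∀ {m n} → m ≢ n → (m ≡ᵇ n) ≡ false
  ≢⇒≡ᵇ-false {m} {n} m≢n with m ≡ᵇ n in e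
  ... | true  = ⊥-elim (m≢n (≡ᵇ-true e))
  ... | false = refl

groupsWith-constantRowsFrom-< : ∀ k r F → k < r → groupsWith (suc k) (constantRowsFrom r F) ≡ 0
groupsWith-constantRowsFrom-< k r []      _   = refl
groupsWith-constantRowsFrom-< k r (f ∷ F) k<r =
  trans (groupsWith-constantRow (suc k) (suc r) f _)
        (trans (cong (λ b → (if b then buoys f else 0) + groupsWith (suc k) (constantRowsFrom (suc r) F))
                     (≢⇒≡ᵇ-false {r} {k} (λ e → <-irrefl (sym e) k<r)))
               (groupsWith-constantRowsFrom-< k (suc r) F (m<n⇒m<1+n k<r)))

groupsWith-constantRowsFrom : ∀ d r F → groupsWith (suc (d + r)) (constantRowsFrom r F) ≡ buoys (row F d)
groupsWith-constantRowsFrom d r [] = refl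
groupsWith-constantRowsFrom zero r (f ∷ F) =
  trans (groupsWith-constantRow (suc r) (suc r) f _)
        (trans (cong₂ (λ b g → (if b then buoys f else 0) + g) (≡ᵇ-refl r)
                      (groupsWith-constantRowsFrom-< r (suc r) F ≤-refl))
               (+-identityʳ (buoys f)))
groupsWith-constantRowsFrom (suc d) r (f ∷ F) =
  trans (groupsWith-constantRow (suc (suc d + r)) (suc r) f _)
        (trans (cong₂ (λ b g → (if b then buoys f else 0) + g)
                      (≢⇒≡ᵇ-false {r} {suc d + r} (m≢1+n+m r))
                      (cong (λ k → groupsWith (suc k) (constantRowsFrom (suc r) F)) (sym (+-suc d r))))
               (groupsWith-constantRowsFrom d (suc r) F))

groupsWith-constantTableau : ∀ k F → groupsWith (suc k) (constantTableau F) ≡ buoys (row F k)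
groupsWith-constantTableau k F =
  trans (cong (λ m → groupsWith (suc m) (constantTableau F)) (sym (+-identityʳ k)))
        (groupsWith-constantRowsFrom k 0 F)

groupsOK-constantRow : ∀ a f → HeadBuoy f → T (groupsOK (map (a ,_) f))
groupsOK-constantRow a (true ∷ f) _ = go f
  where
  go : ∀ xs → T (groupsOK-from a (map (a ,_) xs))
  go []           = tt
  go (true  ∷ xs) with groupsOK-from a (map (a ,_) xs) | go xs
  ... | true | _ = tt
  go (false ∷ xs) = T-∧⁺ (≡⇒≡ᵇ a a refl) (go xs)

all-groupsOK-constantRowsFrom : ∀ r F → (∀ {i} → i < length F → HeadBuoy (row F i)) →
                                T (all groupsOK (constantRowsFrom r F))
all-groupsOK-constantRowsFrom r []      _ = tt
all-groupsOK-constantRowsFrom r (f ∷ F) h =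
  T-∧⁺ (groupsOK-constantRow (suc r) f (h (s≤s z≤n)))
       (all-groupsOK-constantRowsFrom (suc r) F (h ∘ s≤s))

weaklyBelow? : ℕ → Maybe Box → Bool
weaklyBelow? a nothing        = true
weaklyBelow? a (just (b , _)) = a ≤ᵇ b

strictlyBelow? : ℕ → Maybe Box → Bool
strictlyBelow? a nothing        = true
strictlyBelow? a (just (b , _)) = a <ᵇ b

cellOK? : ℕ → Maybe Box → Maybe Box → Maybe Box → Bool
cellOK? n nothing        _ _ = true
cellOK? n (just (a , _)) r d = (1 ≤ᵇ a) ∧ (a ≤ᵇ n) ∧ weaklyBelow? a r ∧ strictlyBelow? a d

cellOK?⁻ : ∀ n a β r d → T (cellOK? n (just (a , β)) r d) →
           1 ≤ a × a ≤ n × T (weaklyBelow? a r) × T (strictlyBelow? a d)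
cellOK?⁻ n a β r d t
  with t₁ , t ← T-∧⁻ {1 ≤ᵇ a} t
  with t₂ , t ← T-∧⁻ {a ≤ᵇ n} t
  with t₃ , t₄ ← T-∧⁻ {weaklyBelow? a r} t =
  ≤ᵇ⇒≤ 1 a t₁ , ≤ᵇ⇒≤ a n t₂ , t₃ , t₄

private
  isVST-local : ∀ n λ' τ → Σ (ℕ → ℕ → Bool) λ cellOK → isVST n λ' τ ≡
    ((length τ ≡ᵇ length λ')
     ∧ allBelow (length λ') (λ i → rowLen τ i ≡ᵇ part λ' i)
     ∧ allBelow (length λ') (λ i → allBelow (part λ' 0) (cellOK i))
     ∧ all groupsOK τ)
  isVST-local n λ' τ = _ , refl

  isVST-local-cellOK : ∀ n λ' τ i j →
    proj₁ (isVST-local n λ' τ) i j ≡ cellOK? n (entryAt τ i j) (entryAt τ i (suc j)) (entryAt τ (suc i) j)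
  isVST-local-cellOK n λ' τ i j with entryAt τ i j
  ... | nothing = refl
  ... | just (a , β) with entryAt τ i (suc j) | entryAt τ (suc i) j
  ... | nothing      | nothing      = refl
  ... | nothing      | just (c , _) = refl
  ... | just (b , _) | nothing      = refl
  ... | just (b , _) | just (c , _) = refl

CellsOK : ℕ → List ℕ → List (List Box) → Set
CellsOK n λ' τ = ∀ {i j} → i < length λ' → j < part λ' 0 →
  T (cellOK? n (entryAt τ i j) (entryAt τ i (suc j)) (entryAt τ (suc i) j))

isVST⁻ : ∀ n λ' τ → T (isVST n λ' τ) →
  length τ ≡ length λ' × (∀ {i} → i < length λ' → rowLen τ i ≡ part λ' i) ×
  CellsOK n λ' τ × T (all groupsOK τ)
isVST⁻ n λ' τ t
  with p₁ , p₂ ← T-∧⁻ (subst T (proj₂ (isVST-local n λ' τ)) t)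
  with p₂ , p₃ ← T-∧⁻ p₂
  with p₃ , p₄ ← T-∧⁻ p₃ =
  ≡ᵇ⇒≡ _ _ p₁ ,
  (λ i< → ≡ᵇ⇒≡ _ _ (allBelow⁻ _ _ p₂ i<)) ,
  (λ {i} {j} i< j< → subst T (isVST-local-cellOK n λ' τ i j) (allBelow⁻ _ _ (allBelow⁻ _ _ p₃ i<) j<)) ,
  p₄

isVST⁺ : ∀ n λ' τ → length τ ≡ length λ' → (∀ {i} → i < length λ' → rowLen τ i ≡ part λ' i) →
         CellsOK n λ' τ → T (all groupsOK τ) → T (isVST n λ' τ)
isVST⁺ n λ' τ p₁ p₂ p₃ p₄ = subst T (sym (proj₂ (isVST-local n λ' τ)))
  (T-∧⁺ (≡⇒≡ᵇ _ _ p₁)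
  (T-∧⁺ (allBelow⁺ _ _ (λ i< → ≡⇒≡ᵇ _ _ (p₂ i<)))
  (T-∧⁺ (allBelow⁺ _ _ (λ {i} i< → allBelow⁺ _ _ (λ {j} j< →
           subst T (sym (isVST-local-cellOK n λ' τ i j)) (p₃ i< j<))))
        p₄)))

cellOK?-constantTableau : ∀ n F i j → suc i ≤ n →
  T (cellOK? n (entryAt (constantTableau F) i j) (entryAt (constantTableau F) i (suc j))
               (entryAt (constantTableau F) (suc i) j))
cellOK?-constantTableau n F i j i<n
  rewrite entryAt-constantTableau F i j | entryAt-constantTableau F i (suc j)
        | entryAt-constantTableau F (suc i) j
  = cell (nth (row F i) j) (nth (row F i) (suc j)) (nth (row F (suc i)) j)
  where
  right : ∀ m → T (weaklyBelow? (suc i) (Maybe.map (suc i ,_) m))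
  right nothing  = tt
  right (just _) = ≤⇒≤ᵇ (≤-refl {suc i})
  down : ∀ m → T (strictlyBelow? (suc i) (Maybe.map (suc (suc i) ,_) m))
  down nothing  = tt
  down (just _) = <⇒<ᵇ (n<1+n (suc i))
  cell : ∀ m₁ m₂ m₃ →
    T (cellOK? n (Maybe.map (suc i ,_) m₁) (Maybe.map (suc i ,_) m₂) (Maybe.map (suc (suc i) ,_) m₃))
  cell nothing  _  _  = tt
  cell (just _) m₂ m₃ = T-∧⁺ (≤⇒≤ᵇ (s≤s (z≤n {i}))) (T-∧⁺ (≤⇒≤ᵇ i<n) (T-∧⁺ (right m₂) (down m₃)))

record HighestWeightFlags (λ' μ : List ℕ) (F : List (List Bool)) : Set where
  field
    length-flags : length F ≡ length λ'
    length-row   : ∀ {i} → i < length λ' → length (row F i) ≡ part λ' i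
    headBuoy-row : ∀ {i} → i < length λ' → HeadBuoy (row F i)
    buoys-row    : ∀ {i} → i < length λ' → buoys (row F i) ≡ part μ i
    bracketed    : ∀ {i} → suc i < length λ' → pairScan 0 (row F i) (row F (suc i)) ≡ 0

module _ {λ' μ : List ℕ} {n : ℕ} {F : List (List Bool)}
         (pλ : IsPartition λ') (μ⊆λ : μ ⊆ₚ λ') (ℓ≤n : ℓ λ' ≤ n) (hw : HighestWeightFlags λ' μ F) where
  open HighestWeightFlags hw

  private
    τ = constantTableau F

    row-≥-flags : ∀ {i} → ¬ i < length λ' → row F i ≡ []
    row-≥-flags i≮ = row-≥ F _ (subst (_≤ _) (sym length-flags) (≮⇒≥ i≮))

    length-row-≤ : ∀ q → length (row F q) ≤ rowLen τ 0
    length-row-≤ q with q <? length λ'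
    ... | no  q≮ = subst (λ r → length r ≤ rowLen τ 0) (sym (row-≥-flags q≮)) z≤n
    ... | yes q< = subst₂ _≤_ (sym (length-row q<))
                               (sym (trans (rowLen-constantTableau F 0) (length-row (≤-trans (s≤s z≤n) q<))))
                               (part-≤-head (proj₁ pλ) q)

    isVST-constantTableau : T (isVST n λ' τ)
    isVST-constantTableau = isVST⁺ n λ' τ
      (trans (length-constantRowsFrom 0 F) length-flags)
      (λ i< → trans (rowLen-constantTableau F _) (length-row i<))
      (λ {i} {j} i< _ → cellOK?-constantTableau n F i j (≤-trans i< ℓ≤n))
      (all-groupsOK-constantRowsFrom 0 F (λ i< → headBuoy-row (subst (_ <_) length-flags i<)))

    hasWeight-constantTableau : T (hasWeight n μ τ)
    hasWeight-constantTableau = allBelow⁺ n _ (λ {k} _ → ≡⇒≡ᵇ _ _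
      (trans (groupsWith-constantTableau k F) (weight k)))
      where
      weight : ∀ k → buoys (row F k) ≡ part μ k
      weight k with k <? length λ'
      ... | yes k< = buoys-row k<
      ... | no  k≮ rewrite row-≥-flags k≮ =
            sym (n≤0⇒n≡0 (subst (part μ k ≤_) (part-≥ λ' k (≮⇒≥ k≮)) (μ⊆λ k)))

    isHighestWeight-constantTableau : T (isHighestWeight n τ)
    isHighestWeight-constantTableau = allBelow⁺ (n ∸ 1) _ (λ {k} _ → ≡⇒≡ᵇ _ _
      (trans (uncancelled-constantTableau F k (length-row-≤ k) (length-row-≤ (suc k))) (balanced k)))
      where
      balanced : ∀ k → pairScan 0 (row F k) (row F (suc k)) ≡ 0
      balanced k with suc k <? length λ'
      ... | yes sk< = bracketed sk<
      ... | no  sk≮ rewrite row-≥-flags sk≮ = ≤⇒pairScan-[]ʳ≡0 0 (row F k) z≤n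

  constantTableau-isHWVST : T (isVST n λ' τ ∧ hasWeight n μ τ ∧ isHighestWeight n τ)
  constantTableau-isHWVST =
    T-∧⁺ isVST-constantTableau (T-∧⁺ hasWeight-constantTableau isHighestWeight-constantTableau)

unbalanced-downFrom : ∀ i (g : ℕ → List ℕ) r L → r < L → g r ≡ suc i ∷ [] →
  (∀ {q} → q < r → All (_≢ i) (g q)) → Unbalanced i (concatMap g (downFrom L))
unbalanced-downFrom i g r (suc L) r<1+L gr above with m<1+n⇒m<n∨m≡n r<1+L
... | inj₁ r<L  = unbalanced-++ˡ i (g L) _ (unbalanced-downFrom i g r L r<L gr above)
... | inj₂ refl rewrite gr = unbalanced-∷ i _ (concat⁺ (map⁺ (applyDownFrom⁺₁ (λ q → q) r above)))

unbalanced-upTo : ∀ i (g : ℕ → List ℕ) c W → c < W → Unbalanced i (g c) →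
  (∀ {j} → c < j → All (_≢ i) (g j)) → Unbalanced i (concatMap g (upTo W))
unbalanced-upTo i g c (suc W) c<1+W u later =
  subst (Unbalanced i) (trans (sym (concatMap-++ g (upTo W) (W ∷ []))) (cong (concatMap g) (upTo-∷ʳ W)))
        (lastColumn (m<1+n⇒m<n∨m≡n c<1+W))
  where
  lastColumn : c < W ⊎ c ≡ W → Unbalanced i (concatMap g (upTo W) ++ g W ++ [])
  lastColumn (inj₁ c<W)  = unbalanced-++ʳ i (concatMap g (upTo W)) (g W ++ [])
                             (unbalanced-upTo i g c W c<W u later) (++⁺ (later c<W) [])
  lastColumn (inj₂ refl) = unbalanced-++ˡ i (concatMap g (upTo c)) (g c ++ [])
                             (unbalanced-++ʳ i (g c) [] u [])

groupsOK-from-sameAsLeft : ∀ a₀ β₀ bs → T (groupsOK-from a₀ bs) →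
  ∀ j {a β b} → nth ((a₀ , β₀) ∷ bs) j ≡ just (a , β) → nth ((a₀ , β₀) ∷ bs) (suc j) ≡ just (b , false) →
  a ≡ b
groupsOK-from-sameAsLeft a₀ β₀ ((c , true) ∷ bs) g j e e′ with groupsOK-from c bs in eq
groupsOK-from-sameAsLeft a₀ β₀ ((c , true) ∷ bs) g zero    e ()   | true
groupsOK-from-sameAsLeft a₀ β₀ ((c , true) ∷ bs) g (suc j) e e′   | true =
  groupsOK-from-sameAsLeft c true bs (subst T (sym eq) tt) j e e′
groupsOK-from-sameAsLeft a₀ β₀ ((c , false) ∷ bs) g zero refl refl =
  ≡ᵇ⇒≡ a₀ c (proj₁ (T-∧⁻ g))
groupsOK-from-sameAsLeft a₀ β₀ ((c , false) ∷ bs) g (suc j) e e′ =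
  groupsOK-from-sameAsLeft c false bs (proj₂ (T-∧⁻ g)) j e e′

groupsOK-headBuoy : ∀ r → T (groupsOK r) → ∀ {a β} → nth r 0 ≡ just (a , β) → β ≡ true
groupsOK-headBuoy ((a , true) ∷ r) _ refl = refl

groupsOK-sameAsLeft : ∀ r → T (groupsOK r) →
  ∀ j {a β b} → nth r j ≡ just (a , β) → nth r (suc j) ≡ just (b , false) → a ≡ b
groupsOK-sameAsLeft ((a , true) ∷ r) g = groupsOK-from-sameAsLeft a true r g

buoyLetter-avoids : ∀ i m → (∀ {x β} → m ≡ just (x , β) → x ≢ i) → All (_≢ i) (buoyLetter m)
buoyLetter-avoids i nothing             _ = []
buoyLetter-avoids i (just (x , false)) _ = []
buoyLetter-avoids i (just (x , true))  h = h refl ∷ []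

module _ {λ' μ : List ℕ} {n : ℕ} {τ : List (List Box)} (pλ : IsPartition λ') (ℓ≤n : ℓ λ' ≤ n)
         (isHW : T (isVST n λ' τ ∧ hasWeight n μ τ ∧ isHighestWeight n τ)) where

  private
    L = length λ'
    vst = isVST⁻ n λ' τ (proj₁ (T-∧⁻ {isVST n λ' τ} isHW))

    weighted : T (hasWeight n μ τ)
    weighted = proj₁ (T-∧⁻ {hasWeight n μ τ} (proj₂ (T-∧⁻ {isVST n λ' τ} isHW)))

    highest : T (isHighestWeight n τ)
    highest = proj₂ (T-∧⁻ {hasWeight n μ τ} (proj₂ (T-∧⁻ {isVST n λ' τ} isHW)))

    length-τ : length τ ≡ L
    length-τ = proj₁ vst

    length-row : ∀ i → length (row τ i) ≡ part λ' i
    length-row i with i <? L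
    ... | yes i<L = trans (sym (rowLen-row τ i)) (proj₁ (proj₂ vst) i<L)
    ... | no  i≮L = trans (cong length (row-≥ τ i (subst (_≤ i) (sym length-τ) (≮⇒≥ i≮L))))
                          (sym (part-≥ λ' i (≮⇒≥ i≮L)))

    E : ℕ → ℕ → Maybe Box
    E i j = nth (row τ i) j

    E-just⇒< : ∀ i j {b} → E i j ≡ just b → j < part λ' i
    E-just⇒< i j e = subst (j <_) (length-row i) (nth-just⇒< (row τ i) j e)

    E-just⇒row< : ∀ i j {b} → E i j ≡ just b → i < L
    E-just⇒row< i j e with i <? L
    ... | yes i<L = i<L
    ... | no  i≮L = ⊥-elim (n≮0 (subst (j <_) (part-≥ λ' i (≮⇒≥ i≮L)) (E-just⇒< i j e)))

    <⇒E-just : ∀ i j → j < part λ' i → Σ Box λ b → E i j ≡ just b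
    <⇒E-just i j j< = <⇒nth-just (row τ i) j (subst (j <_) (sym (length-row i)) j<)

    cell : ∀ i j {a β} → E i j ≡ just (a , β) →
           1 ≤ a × a ≤ n × T (weaklyBelow? a (E i (suc j))) × T (strictlyBelow? a (E (suc i) j))
    cell i j {a} {β} e = cellOK?⁻ n a β (E i (suc j)) (E (suc i) j)
     (subst (λ m → T (cellOK? n m (E i (suc j)) (E (suc i) j))) e
      (subst₂ (λ x y → T (cellOK? n (E i j) x y)) (entryAt-row τ i (suc j)) (entryAt-row τ (suc i) j)
        (subst (λ x → T (cellOK? n x (entryAt τ i (suc j)) (entryAt τ (suc i) j))) (entryAt-row τ i j)
          (proj₁ (proj₂ (proj₂ vst)) (E-just⇒row< i j e)
            (≤-trans (E-just⇒< i j e) (part-≤-head (proj₁ pλ) i))))))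

    entry-positive : ∀ i j {a β} → E i j ≡ just (a , β) → 1 ≤ a
    entry-positive i j e = proj₁ (cell i j e)

    entry-≤n : ∀ i j {a β} → E i j ≡ just (a , β) → a ≤ n
    entry-≤n i j e = proj₁ (proj₂ (cell i j e))

    entry-≤-right : ∀ i j {a β b γ} → E i j ≡ just (a , β) → E i (suc j) ≡ just (b , γ) → a ≤ b
    entry-≤-right i j {a} e e′ =
      ≤ᵇ⇒≤ a _ (subst (T ∘ weaklyBelow? a) e′ (proj₁ (proj₂ (proj₂ (cell i j e)))))

    entry-<-down : ∀ i j {a β b γ} → E i j ≡ just (a , β) → E (suc i) j ≡ just (b , γ) → a < b
    entry-<-down i j {a} e e′ =
      <ᵇ⇒< a _ (subst (T ∘ strictlyBelow? a) e′ (proj₂ (proj₂ (proj₂ (cell i j e)))))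

    entry-≥-row : ∀ i j {a β} → E i j ≡ just (a , β) → suc i ≤ a
    entry-≥-row zero    j e = entry-positive zero j e
    entry-≥-row (suc i) j e
      with _ , e′ ← <⇒E-just i j (≤-trans (E-just⇒< (suc i) j e) (part-suc-≤ (proj₁ pλ) i)) =
      ≤-trans (s≤s (entry-≥-row i j e′)) (entry-<-down i j e′ e)

    entry-monotone-right : ∀ d i j {a β b γ} → E i j ≡ just (a , β) → E i (d + j) ≡ just (b , γ) → a ≤ b
    entry-monotone-right zero    i j e e′ = ≤-reflexive (cong proj₁ (just-injective (trans (sym e) e′)))
    entry-monotone-right (suc d) i j e e′
      with _ , e″ ← <⇒E-just i (d + j) (<-trans (n<1+n (d + j)) (E-just⇒< i (suc d + j) e′)) =
      ≤-trans (entry-monotone-right d i j e e″) (entry-≤-right i (d + j) e″ e′)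

    entry-monotone-down : ∀ d i j {a β b γ} → E i j ≡ just (a , β) → E (d + i) j ≡ just (b , γ) → a ≤ b
    entry-monotone-down zero    i j e e′ = ≤-reflexive (cong proj₁ (just-injective (trans (sym e) e′)))
    entry-monotone-down (suc d) i j e e′
      with _ , e″ ← <⇒E-just (d + i) j (≤-trans (E-just⇒< (suc d + i) j e′) (part-suc-≤ (proj₁ pλ) (d + i))) =
      ≤-trans (entry-monotone-down d i j e e″) (<⇒≤ (entry-<-down (d + i) j e″ e′))

    entry-monotone : ∀ {r c q j a β b γ} → r ≤ q → c ≤ j → E r c ≡ just (a , β) → E q j ≡ just (b , γ) → a ≤ b
    entry-monotone {r} {c} {q} {j} r≤q c≤j e e′
      with _ , e″ ← <⇒E-just r j (≤-trans (E-just⇒< q j e′) (part-antitone (proj₁ pλ) r≤q)) =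
      ≤-trans (entry-monotone-right (j ∸ c) r c e (subst (λ k → E r k ≡ _) (sym (m∸n+n≡m c≤j)) e″))
              (entry-monotone-down (q ∸ r) r j e″ (subst (λ k → E k j ≡ _) (sym (m∸n+n≡m r≤q)) e′))

  RowConstant : ℕ → Set
  RowConstant r = ∀ j {a β} → nth (row τ r) j ≡ just (a , β) → a ≡ suc r

  private
    no-high-buoy : ∀ r c k → (∀ {q} → q < r → RowConstant q) → r ≤ k → E r c ≡ just (suc (suc k) , true) → ⊥
    no-high-buoy r c k above r≤k e = 1≰0 (subst (1 ≤_) balanced (unbalanced 0))
      where
      1≰0 : ¬ 1 ≤ 0
      1≰0 ()
      k<n∸1 : k < n ∸ 1
      k<n∸1 = suc[m]≤n⇒m≤pred[n] (entry-≤n r c e)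
      balanced : uncancelledMinus-from (suc k) 0 (concatMap (column τ) (upTo (rowLen τ 0))) ≡ 0
      balanced = trans (cong (uncancelledMinus-from (suc k) 0) (sym (readingWord-columns τ)))
                       (≡ᵇ⇒≡ _ 0 (allBelow⁻ (n ∸ 1) _ highest k<n∸1))
      above-avoids : ∀ j {q} → q < r → All (_≢ suc k) (buoyLetter (entryAt τ q j))
      above-avoids j {q} q<r = buoyLetter-avoids (suc k) _ (λ e′ x≡ →
        <-irrefl (trans (sym (above q<r j (trans (sym (entryAt-row τ q j)) e′))) x≡) (s≤s (≤-trans q<r r≤k)))
      unbalanced : Unbalanced (suc k) (concatMap (column τ) (upTo (rowLen τ 0)))
      unbalanced = unbalanced-upTo (suc k) (column τ) c (rowLen τ 0)
        (subst (c <_) (sym (trans (rowLen-row τ 0) (length-row 0)))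
               (≤-trans (E-just⇒< r c e) (part-≤-head (proj₁ pλ) r)))
        (unbalanced-downFrom (suc k) (λ q → buoyLetter (entryAt τ q c)) r (length τ)
           (subst (r <_) (sym length-τ) (E-just⇒row< r c e))
           (cong buoyLetter (trans (entryAt-row τ r c) e)) (above-avoids c))
        (λ {j} c<j → concat⁺ (map⁺ (applyDownFrom⁺₁ (λ q → q) (length τ) (λ {q} _ → later c<j q))))
        where
        later : ∀ {j} → c < j → ∀ q → All (_≢ suc k) (buoyLetter (entryAt τ q j))
        later {j} c<j q with q <? r
        ... | yes q<r = above-avoids j q<r
        ... | no  q≮r = buoyLetter-avoids (suc k) _ (λ e′ x≡ → <-irrefl (sym x≡)
                          (entry-monotone (≮⇒≥ q≮r) (<⇒≤ c<j) e (trans (sym (entryAt-row τ q j)) e′)))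

    groupsOK-row : ∀ {i} → i < L → T (groupsOK (row τ i))
    groupsOK-row {i} i<L with r , e ← <⇒nth-just τ i (subst (i <_) (sym length-τ) i<L) =
      subst (T ∘ groupsOK) (sym (row-nth τ i e)) (all-nth⁻ groupsOK τ (proj₂ (proj₂ (proj₂ vst))) i e)

    row-constant : ∀ r → (∀ {q} → q < r → RowConstant q) → RowConstant r
    row-constant r above j {a} {true} e with m≤n⇒m<n∨m≡n (entry-≥-row r j e)
    ... | inj₁ r+1<a = ⊥-elim (high r+1<a e)
      where
      high : ∀ {a} → suc r < a → E r j ≡ just (a , true) → ⊥
      high {suc (suc k)} (s≤s (s≤s r≤k)) = no-high-buoy r j k above r≤k
    ... | inj₂ r+1≡a = sym r+1≡a
    row-constant r above zero {a} {false} e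
      with () ← groupsOK-headBuoy (row τ r) (groupsOK-row (E-just⇒row< r 0 e)) e
    row-constant r above (suc j) {a} {false} e
      with _ , e′ ← <⇒E-just r j (<-trans (n<1+n j) (E-just⇒< r (suc j) e)) =
      trans (sym (groupsOK-sameAsLeft (row τ r) (groupsOK-row (E-just⇒row< r j e′)) j e′ e))
            (row-constant r above j e′)

    rows-constant : ∀ r → RowConstant r
    rows-constant = <-rec RowConstant row-constant

  highestWeight-constantTableau : τ ≡ constantTableau (flags τ)
  highestWeight-constantTableau = constantRowsFrom-flags 0 τ rows-constant

  highestWeight-flags : HighestWeightFlags λ' μ (flags τ)
  highestWeight-flags = record
    { length-flags = trans (length-map (map proj₂) τ) length-τ
    ; length-row   = λ {i} _ → length-flagRow i
    ; headBuoy-row = headBuoy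
    ; buoys-row    = λ {i} i<L → trans (sym (groupsWith-constantTableau i (flags τ)))
                       (trans (cong (groupsWith (suc i)) (sym highestWeight-constantTableau))
                              (≡ᵇ⇒≡ _ _ (allBelow⁻ n _ weighted (≤-trans i<L ℓ≤n))))
    ; bracketed    = λ {i} si<L → trans (sym (uncancelled-constantTableau (flags τ) i
                                              (length-flagRow-≤ i) (length-flagRow-≤ (suc i))))
                       (trans (cong (uncancelledMinus (suc i) ∘ readingWord) (sym highestWeight-constantTableau))
                              (balanced (suc[m]≤n⇒m≤pred[n] (≤-trans si<L ℓ≤n))))
    }
    where
    balanced : ∀ {i} → i < n ∸ 1 → uncancelledMinus (suc i) (readingWord τ) ≡ 0
    balanced i< = ≡ᵇ⇒≡ _ 0 (allBelow⁻ (n ∸ 1) _ highest i<)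
    length-flagRow : ∀ i → length (row (flags τ) i) ≡ part λ' i
    length-flagRow i =
      trans (cong length (row-map proj₂ τ i)) (trans (length-map proj₂ (row τ i)) (length-row i))
    length-flagRow-≤ : ∀ i → length (row (flags τ) i) ≤ rowLen (constantTableau (flags τ)) 0
    length-flagRow-≤ i = subst₂ _≤_ (sym (length-flagRow i))
      (sym (trans (rowLen-constantTableau (flags τ) 0) (length-flagRow 0))) (part-≤-head (proj₁ pλ) i)
    headBuoy : ∀ {i} → i < L → HeadBuoy (row (flags τ) i)
    headBuoy {i} i<L with (a , β) , e ← <⇒E-just i 0 (part-positive (proj₂ pλ) i<L) =
      subst HeadBuoy (sym (row-map proj₂ τ i))
        (head (row τ i) e (groupsOK-headBuoy (row τ i) (groupsOK-row i<L) e))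
      where
      head : ∀ r → nth r 0 ≡ just (a , β) → β ≡ true → HeadBuoy (map proj₂ r)
      head ((_ , .true) ∷ r) refl refl = tt

shiftedEntry : ℕ → List ℕ → ℕ → Maybe ℕ
shiftedEntry m r c = if c <ᵇ m then nothing else nth r (c ∸ m)

rppAt-row : ∀ μ P i c → rppAt μ P i c ≡ shiftedEntry (part μ i) (row P i) c
rppAt-row μ P i c with nth P i
... | just r  = refl
... | nothing with c <ᵇ part μ i
...   | true  = refl
...   | false = refl

shiftedEntry-< : ∀ m r c → c < m → shiftedEntry m r c ≡ nothing
shiftedEntry-< m r c c<m rewrite Equivalence.to T-≡ (<⇒<ᵇ c<m) = refl

shiftedEntry-≥ : ∀ m r c → m ≤ c → shiftedEntry m r c ≡ nth r (c ∸ m)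
shiftedEntry-≥ m r c m≤c with c <ᵇ m in e
... | true  = ⊥-elim (<⇒≱ (<ᵇ⇒< c m (subst T (sym e) tt)) m≤c)
... | false = refl

shiftedEntry-[] : ∀ m c → shiftedEntry m [] c ≡ nothing
shiftedEntry-[] m c with c <ᵇ m
... | true  = refl
... | false = refl

shiftedEntry-+ : ∀ m r j → shiftedEntry m r (m + j) ≡ nth r j
shiftedEntry-+ m r j = trans (shiftedEntry-≥ m r (m + j) (m≤m+n m j)) (cong (nth r) (m+n∸m≡n m j))

weaklyBelowℕ? : ℕ → Maybe ℕ → Bool
weaklyBelowℕ? a nothing  = true
weaklyBelowℕ? a (just b) = a ≤ᵇ b

rppCellOK? : ℕ → ℕ → Maybe ℕ → Maybe ℕ → Maybe ℕ → Bool
rppCellOK? lo hi nothing  _ _ = true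
rppCellOK? lo hi (just a) r d = (1 ≤ᵇ a) ∧ (lo ≤ᵇ a) ∧ (a ≤ᵇ hi) ∧ weaklyBelowℕ? a r ∧ weaklyBelowℕ? a d

RppCell : ℕ → ℕ → Maybe ℕ → Maybe ℕ → Maybe ℕ → Set
RppCell lo hi m r d = ∀ {a} → m ≡ just a →
  1 ≤ a × lo ≤ a × a ≤ hi × (∀ {b} → r ≡ just b → a ≤ b) × (∀ {b} → d ≡ just b → a ≤ b)

weaklyBelowℕ?⁻ : ∀ a m → T (weaklyBelowℕ? a m) → ∀ {b} → m ≡ just b → a ≤ b
weaklyBelowℕ?⁻ a (just b) t refl = ≤ᵇ⇒≤ a b t

weaklyBelowℕ?⁺ : ∀ a m → (∀ {b} → m ≡ just b → a ≤ b) → T (weaklyBelowℕ? a m)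
weaklyBelowℕ?⁺ a nothing  _ = tt
weaklyBelowℕ?⁺ a (just b) h = ≤⇒≤ᵇ (h refl)

rppCellOK?⁻ : ∀ lo hi m r d → T (rppCellOK? lo hi m r d) → RppCell lo hi m r d
rppCellOK?⁻ lo hi (just a) r d t refl
  with t₁ , t ← T-∧⁻ {1 ≤ᵇ a} t
  with t₂ , t ← T-∧⁻ {lo ≤ᵇ a} t
  with t₃ , t ← T-∧⁻ {a ≤ᵇ hi} t
  with t₄ , t₅ ← T-∧⁻ {weaklyBelowℕ? a r} t =
  ≤ᵇ⇒≤ 1 a t₁ , ≤ᵇ⇒≤ lo a t₂ , ≤ᵇ⇒≤ a hi t₃ , weaklyBelowℕ?⁻ a r t₄ , weaklyBelowℕ?⁻ a d t₅

rppCellOK?⁺ : ∀ lo hi m r d → RppCell lo hi m r d → T (rppCellOK? lo hi m r d)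
rppCellOK?⁺ lo hi nothing  r d h = tt
rppCellOK?⁺ lo hi (just a) r d h with p₁ , p₂ , p₃ , p₄ , p₅ ← h refl =
  T-∧⁺ (≤⇒≤ᵇ p₁) (T-∧⁺ (≤⇒≤ᵇ p₂) (T-∧⁺ (≤⇒≤ᵇ p₃) (T-∧⁺ (weaklyBelowℕ?⁺ a r p₄) (weaklyBelowℕ?⁺ a d p₅))))

private
  isBoundedRPP-local : ∀ λ' μ P → Σ (ℕ → Bool) λ rowOK → Σ (ℕ → ℕ → Bool) λ cellOK → isBoundedRPP λ' μ P ≡
    ((length P ≡ᵇ length λ')
     ∧ allBelow (length λ') rowOK
     ∧ allBelow (length λ') (λ i → allBelow (part λ' 0) (cellOK i)))
  isBoundedRPP-local λ' μ P = _ , _ , refl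

  isBoundedRPP-local-rowOK : ∀ λ' μ P i →
    proj₁ (isBoundedRPP-local λ' μ P) i ≡ (length (row P i) ≡ᵇ (part λ' i ∸ part μ i))
  isBoundedRPP-local-rowOK λ' μ P i with nth P i
  ... | nothing = refl
  ... | just r  = refl

  isBoundedRPP-local-cellOK : ∀ λ' μ P i c → proj₁ (proj₂ (isBoundedRPP-local λ' μ P)) i c ≡
    rppCellOK? (part μ 0 + 1 ∸ part μ i) (part μ 0)
               (rppAt μ P i c) (rppAt μ P i (suc c)) (rppAt μ P (suc i) c)
  isBoundedRPP-local-cellOK λ' μ P i c with rppAt μ P i c
  ... | nothing = refl
  ... | just a with rppAt μ P i (suc c) | rppAt μ P (suc i) c
  ... | nothing | nothing = refl
  ... | nothing | just d  = refl
  ... | just b  | nothing = refl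
  ... | just b  | just d  = refl

-- Row i of λ/μ starts in column μ_i, so the box below the j-th box of
-- row i is the ((μ_i − μ_{i+1}) + j)-th box of row i+1.
record BoundedRPPRows (λ' μ : List ℕ) (P : List (List ℕ)) : Set where
  field
    length-rows   : length P ≡ length λ'
    length-row    : ∀ {i} → i < length λ' → length (row P i) ≡ part λ' i ∸ part μ i
    entry-bounded : ∀ {i j v} → i < length λ' → nth (row P i) j ≡ just v →
                    part μ 0 + 1 ∸ part μ i ≤ v × v ≤ part μ 0
    row-sorted    : ∀ {i j u v} → i < length λ' →
                    nth (row P i) j ≡ just u → nth (row P i) (suc j) ≡ just v → u ≤ v
    column-sorted : ∀ {i j u v} → suc i < length λ' →
                    nth (row P i) j ≡ just u →
                    nth (row P (suc i)) ((part μ i ∸ part μ (suc i)) + j) ≡ just v → u ≤ v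

module _ {λ' μ : List ℕ} (aλ : Antitone λ') (aμ : Antitone μ) (μ⊆λ : μ ⊆ₚ λ') where

  private
    L  = length λ'
    μ₁ = part μ 0

    lo : ℕ → ℕ
    lo i = μ₁ + 1 ∸ part μ i

    Cell : List (List ℕ) → ℕ → ℕ → Set
    Cell P i c = RppCell (lo i) μ₁ (shiftedEntry (part μ i) (row P i) c)
                   (shiftedEntry (part μ i) (row P i) (suc c))
                   (shiftedEntry (part μ (suc i)) (row P (suc i)) c)

    cellOK-spec : ∀ P i c → proj₁ (proj₂ (isBoundedRPP-local λ' μ P)) i c ≡
      rppCellOK? (lo i) μ₁ (shiftedEntry (part μ i) (row P i) c)
        (shiftedEntry (part μ i) (row P i) (suc c)) (shiftedEntry (part μ (suc i)) (row P (suc i)) c)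
    cellOK-spec P i c = trans (isBoundedRPP-local-cellOK λ' μ P i c)
      (cong₃ (rppCellOK? (lo i) μ₁) (rppAt-row μ P i c) (rppAt-row μ P i (suc c)) (rppAt-row μ P (suc i) c))
      where
      cong₃ : ∀ {A B C D : Set} (f : A → B → C → D) {a a′ b b′ c c′} →
              a ≡ a′ → b ≡ b′ → c ≡ c′ → f a b c ≡ f a′ b′ c′
      cong₃ f refl refl refl = refl

    lower-index : ∀ i j → part μ i + j ∸ part μ (suc i) ≡ (part μ i ∸ part μ (suc i)) + j
    lower-index i j = trans (cong (_∸ part μ (suc i)) (+-comm (part μ i) j))
                            (trans (+-∸-assoc j (part-suc-≤ aμ i)) (+-comm j _))

    lower-entry : ∀ P i j → shiftedEntry (part μ (suc i)) (row P (suc i)) (part μ i + j) ≡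
                            nth (row P (suc i)) ((part μ i ∸ part μ (suc i)) + j)
    lower-entry P i j =
      trans (shiftedEntry-≥ (part μ (suc i)) (row P (suc i)) (part μ i + j)
                            (≤-trans (part-suc-≤ aμ i) (m≤m+n _ j)))
                              (cong (nth (row P (suc i))) (lower-index i j))

  isBoundedRPP⁻ : ∀ P → T (isBoundedRPP λ' μ P) → BoundedRPPRows λ' μ P
  isBoundedRPP⁻ P t
    with t₁ , t ← T-∧⁻ {length P ≡ᵇ L} (subst T (proj₂ (proj₂ (isBoundedRPP-local λ' μ P))) t)
    with t₂ , t₃ ← T-∧⁻ {allBelow L (proj₁ (isBoundedRPP-local λ' μ P))} t = record
    { length-rows   = ≡ᵇ⇒≡ _ _ t₁
    ; length-row    = length-row
    ; entry-bounded = λ i<L e → let _ , p₂ , p₃ , _ = cellAt i<L e in p₂ , p₃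
    ; row-sorted    = λ {i} {j} i<L e e′ → proj₁ (proj₂ (proj₂ (proj₂ (cellAt i<L e))))
                        (trans (cong (shiftedEntry (part μ i) (row P i)) (sym (+-suc (part μ i) j)))
                               (trans (shiftedEntry-+ (part μ i) (row P i) (suc j)) e′))
    ; column-sorted = λ {i} {j} si<L e e′ → proj₂ (proj₂ (proj₂ (proj₂ (cellAt (<-trans (n<1+n i) si<L) e))))
                        (trans (lower-entry P i j) e′)
    }
    where
    length-row : ∀ {i} → i < L → length (row P i) ≡ part λ' i ∸ part μ i
    length-row {i} i<L = ≡ᵇ⇒≡ _ _ (subst T (isBoundedRPP-local-rowOK λ' μ P i) (allBelow⁻ L _ t₂ i<L))
    cellAt : ∀ {i j v} → i < L → nth (row P i) j ≡ just v →
      1 ≤ v × lo i ≤ v × v ≤ μ₁ ×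
      (∀ {b} → shiftedEntry (part μ i) (row P i) (suc (part μ i + j)) ≡ just b → v ≤ b) ×
      (∀ {b} → shiftedEntry (part μ (suc i)) (row P (suc i)) (part μ i + j) ≡ just b → v ≤ b)
    cellAt {i} {j} i<L e = rppCellOK?⁻ _ _ _ _ _
      (subst T (cellOK-spec P i (part μ i + j)) (allBelow⁻ _ _ (allBelow⁻ L _ t₃ i<L) column<))
      (trans (shiftedEntry-+ (part μ i) (row P i) j) e)
      where
      column< : part μ i + j < part λ' 0
      column< = ≤-trans (subst (_≤ part μ i + (part λ' i ∸ part μ i)) (+-suc (part μ i) j)
                                (+-monoʳ-≤ (part μ i) (subst (j <_) (length-row i<L) (nth-just⇒< (row P i) j e))))
                        (≤-trans (≤-reflexive (m+[n∸m]≡n (μ⊆λ i))) (part-≤-head aλ i))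

  isBoundedRPP⁺ : ∀ P → BoundedRPPRows λ' μ P → T (isBoundedRPP λ' μ P)
  isBoundedRPP⁺ P rows = subst T (sym (proj₂ (proj₂ (isBoundedRPP-local λ' μ P))))
    (T-∧⁺ (≡⇒≡ᵇ _ _ length-rows)
    (T-∧⁺ (allBelow⁺ L _ (λ {i} i<L →
             subst T (sym (isBoundedRPP-local-rowOK λ' μ P i)) (≡⇒≡ᵇ _ _ (length-row i<L))))
          (allBelow⁺ L _ (λ {i} i<L → allBelow⁺ (part λ' 0) _ (λ {c} _ →
             subst T (sym (cellOK-spec P i c)) (rppCellOK?⁺ _ _ _ _ _ (cell i<L c)))))))
    where
    open BoundedRPPRows rows
    1≤lo : ∀ i → 1 ≤ lo i
    1≤lo i = subst (1 ≤_) (sym (trans (+-∸-comm 1 (part-≤-head aμ i)) (+-comm _ 1))) (s≤s z≤n)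
    cellFrom : ∀ {i} j → i < L → Cell P i (part μ i + j)
    cellFrom {i} j i<L {a} e = ≤-trans (1≤lo i) (proj₁ bounded) , proj₁ bounded , proj₂ bounded , right , down
      where
      e₀ : nth (row P i) j ≡ just a
      e₀ = trans (sym (shiftedEntry-+ (part μ i) (row P i) j)) e
      bounded = entry-bounded i<L e₀
      right : ∀ {b} → shiftedEntry (part μ i) (row P i) (suc (part μ i + j)) ≡ just b → a ≤ b
      right e′ = row-sorted i<L e₀ (trans (sym (shiftedEntry-+ (part μ i) (row P i) (suc j)))
                                          (trans (cong (shiftedEntry (part μ i) (row P i)) (+-suc (part μ i) j)) e′))
      down : ∀ {b} → shiftedEntry (part μ (suc i)) (row P (suc i)) (part μ i + j) ≡ just b → a ≤ b
      down e′ with suc i <? L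
      ... | yes si<L = column-sorted si<L e₀ (trans (sym (lower-entry P i j)) e′)
      ... | no  si≮L with () ← trans (sym (shiftedEntry-[] (part μ (suc i)) (part μ i + j)))
                                 (trans (cong (λ r → shiftedEntry (part μ (suc i)) r (part μ i + j))
                                 (sym (row-≥ P (suc i) (subst (_≤ suc i) (sym length-rows) (≮⇒≥ si≮L))))) e′)
    cell : ∀ {i} → i < L → ∀ c → Cell P i c
    cell {i} i<L c with c <? part μ i
    ... | yes c<μ = λ e → case (trans (sym (shiftedEntry-< (part μ i) (row P i) c c<μ)) e) of λ ()
    ... | no  c≮μ = subst (Cell P i) (m+[n∸m]≡n (≮⇒≥ c≮μ)) (cellFrom (c ∸ part μ i) i<L)

offset : List ℕ → ℕ → ℕ
offset μ i = part μ 0 ∸ part μ i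

encodeRowsFrom : List ℕ → ℕ → List (List Bool) → List (List ℕ)
encodeRowsFrom μ s []      = []
encodeRowsFrom μ s (f ∷ F) = encodeRow (offset μ s) f ∷ encodeRowsFrom μ (suc s) F

decodeRowsFrom : List ℕ → ℕ → List (List ℕ) → List (List Bool)
decodeRowsFrom μ s []      = []
decodeRowsFrom μ s (p ∷ P) = decodeRow (part μ 0) (offset μ s) p ∷ decodeRowsFrom μ (suc s) P

length-encodeRowsFrom : ∀ μ s F → length (encodeRowsFrom μ s F) ≡ length F
length-encodeRowsFrom μ s []      = refl
length-encodeRowsFrom μ s (f ∷ F) = cong suc (length-encodeRowsFrom μ (suc s) F)

length-decodeRowsFrom : ∀ μ s P → length (decodeRowsFrom μ s P) ≡ length P
length-decodeRowsFrom μ s []      = refl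
length-decodeRowsFrom μ s (p ∷ P) = cong suc (length-decodeRowsFrom μ (suc s) P)

row-encodeRowsFrom : ∀ μ s F i → row (encodeRowsFrom μ s F) i ≡ encodeRow (offset μ (s + i)) (row F i)
row-encodeRowsFrom μ s []      i       = refl
row-encodeRowsFrom μ s (f ∷ F) zero    = cong (λ k → encodeRow (offset μ k) f) (sym (+-identityʳ s))
row-encodeRowsFrom μ s (f ∷ F) (suc i) =
  trans (row-encodeRowsFrom μ (suc s) F i) (cong (λ k → encodeRow (offset μ k) (row F i)) (sym (+-suc s i)))

row-decodeRowsFrom : ∀ μ s P i → i < length P →
  row (decodeRowsFrom μ s P) i ≡ decodeRow (part μ 0) (offset μ (s + i)) (row P i)
row-decodeRowsFrom μ s (p ∷ P) zero    _         =
  cong (λ k → decodeRow (part μ 0) (offset μ k) p) (sym (+-identityʳ s))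
row-decodeRowsFrom μ s (p ∷ P) (suc i) (s≤s i<P) =
  trans (row-decodeRowsFrom μ (suc s) P i i<P)
        (cong (λ k → decodeRow (part μ 0) (offset μ k) (row P i)) (sym (+-suc s i)))

decodeRowsFrom-encodeRowsFrom : ∀ μ s F →
  (∀ {i} → i < length F → offset μ (s + i) + buoys (row F i) ≡ part μ 0) →
  decodeRowsFrom μ s (encodeRowsFrom μ s F) ≡ F
decodeRowsFrom-encodeRowsFrom μ s []      _ = refl
decodeRowsFrom-encodeRowsFrom μ s (f ∷ F) h = cong₂ _∷_
  (decodeRow-encodeRow (part μ 0) (offset μ s) f
    (subst (λ k → offset μ k + buoys f ≡ part μ 0) (+-identityʳ s) (h (s≤s z≤n))))
  (decodeRowsFrom-encodeRowsFrom μ (suc s) F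
    (λ {i} i<F → subst (λ k → offset μ k + buoys (row F i) ≡ part μ 0) (+-suc s i) (h (s≤s i<F))))

encodeRowsFrom-decodeRowsFrom : ∀ μ s P →
  (∀ {i} → i < length P → SortedWithin (part μ 0) (offset μ (s + i)) (row P i)) →
  encodeRowsFrom μ s (decodeRowsFrom μ s P) ≡ P
encodeRowsFrom-decodeRowsFrom μ s []      _ = refl
encodeRowsFrom-decodeRowsFrom μ s (p ∷ P) h = cong₂ _∷_
  (encodeRow-decodeRow (part μ 0) (offset μ s) p
    (subst (λ k → SortedWithin (part μ 0) (offset μ k) p) (+-identityʳ s) (h (s≤s z≤n))))
  (encodeRowsFrom-decodeRowsFrom μ (suc s) P
    (λ {i} i<P → subst (λ k → SortedWithin (part μ 0) (offset μ k) (row P i)) (+-suc s i) (h (s≤s i<P))))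

module _ {λ' μ : List ℕ} (pλ : IsPartition λ') (aμ : Antitone μ) (μ⊆λ : μ ⊆ₚ λ') where

  private
    L  = length λ'
    μ₁ = part μ 0
    o  = offset μ
    aλ = proj₁ pλ

    drop-μ : ℕ → ℕ
    drop-μ i = part μ i ∸ part μ (suc i)

    μ≤μ₁ : ∀ i → part μ i ≤ μ₁
    μ≤μ₁ = part-≤-head aμ

    o+μ : ∀ i → o i + part μ i ≡ μ₁
    o+μ i = m∸n+n≡m (μ≤μ₁ i)

    μ₁∸o : ∀ i → μ₁ ∸ o i ≡ part μ i
    μ₁∸o i = m∸[m∸n]≡n (μ≤μ₁ i)

    lo≡1+o : ∀ i → μ₁ + 1 ∸ part μ i ≡ suc (o i)
    lo≡1+o i = trans (+-∸-comm 1 (μ≤μ₁ i)) (+-comm (o i) 1)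

    o+drop : ∀ i → o i + drop-μ i ≡ o (suc i)
    o+drop i = trans (sym (+-∸-assoc (o i) (part-suc-≤ aμ i))) (cong (_∸ part μ (suc i)) (o+μ i))

  flags⇒boundedRPP : ∀ {F} → HighestWeightFlags λ' μ F → BoundedRPPRows λ' μ (encodeRowsFrom μ 0 F)
  flags⇒boundedRPP {F} hw = record
    { length-rows   = trans (length-encodeRowsFrom μ 0 F) length-flags
    ; length-row    = λ {i} i<L → trans (cong length (row-encodeRowsFrom μ 0 F i))
        (trans (sym (m+n∸n≡m _ (buoys (row F i))))
               (cong₂ _∸_ (trans (length-encodeRow (o i) (row F i)) (length-row i<L)) (buoys-row i<L)))
    ; entry-bounded = λ {i} {j} i<L e → bounded i<L (subst (λ r → nth r j ≡ _) (row-encodeRowsFrom μ 0 F i) e)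
    ; row-sorted    = λ {i} {j} _ e e′ → encodeRow-sorted (o i) (row F i) j
        (subst (λ r → nth r j ≡ _) (row-encodeRowsFrom μ 0 F i) e)
        (subst (λ r → nth r (suc j) ≡ _) (row-encodeRowsFrom μ 0 F i) e′)
    ; column-sorted = λ {i} {j} si<L e e′ → columns si<L j
        (subst (λ r → nth r j ≡ _) (row-encodeRowsFrom μ 0 F i) e)
        (subst (λ r → nth r (drop-μ i + j) ≡ _) (row-encodeRowsFrom μ 0 F (suc i)) e′)
    }
    where
    open HighestWeightFlags hw
    bounded : ∀ {i j v} → i < L → nth (encodeRow (o i) (row F i)) j ≡ just v → μ₁ + 1 ∸ part μ i ≤ v × v ≤ μ₁
    bounded {i} {j} {v} i<L e with row F i | headBuoy-row i<L | buoys-row i<L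
    ... | true ∷ f | _ | buoys≡ =
      subst (_≤ v) (sym (lo≡1+o i)) (encodeRow-≥ (suc (o i)) f j e) ,
      ≤-trans (encodeRow-≤ (o i) (true ∷ f) j e) (≤-reflexive (trans (cong (o i +_) buoys≡) (o+μ i)))
    shorter : ∀ {i} → suc i < L → length (row F (suc i)) ≤ length (row F i)
    shorter {i} si<L = subst₂ _≤_ (sym (length-row si<L)) (sym (length-row (<-trans (n<1+n i) si<L)))
                              (part-suc-≤ aλ i)
    dominates : ∀ {i} → suc i < L → Dominates (drop-μ i) (row F i) (row F (suc i))
    dominates {i} si<L = subst (λ s → Dominates s (row F i) (row F (suc i)))
      (cong₂ _∸_ (buoys-row (<-trans (n<1+n i) si<L)) (buoys-row si<L))
      (proj₂ (pairScan≡0⇒dominates 0 (row F i) (row F (suc i)) (bracketed si<L)))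
    columns : ∀ {i} → suc i < L → ∀ j {u v} → nth (encodeRow (o i) (row F i)) j ≡ just u →
              nth (encodeRow (o (suc i)) (row F (suc i))) (drop-μ i + j) ≡ just v → u ≤ v
    columns {i} si<L j e e′
      with u′ , e″ , u′≤v ← dominates⇒columnWeak (o i) (row F i) (o (suc i)) (row F (suc i)) (drop-μ i)
                               (o+drop i) (shorter si<L) (dominates si<L) j _ e′ =
      subst (_≤ _) (just-injective (trans (sym e″) e)) u′≤v

  boundedRPP-sortedWithin : ∀ {P} → BoundedRPPRows λ' μ P → ∀ {i} → i < L → SortedWithin μ₁ (o i) (row P i)
  boundedRPP-sortedWithin {P} rows {i} i<L = sortedWithin μ₁ (o i) (row P i) (m∸n≤m μ₁ (part μ i))
    (λ j e → proj₂ (entry-bounded i<L e))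
    (λ {u} e → ≤-trans (n≤1+n (o i)) (subst (_≤ u) (lo≡1+o i) (proj₁ (entry-bounded i<L e))))
    (λ j → row-sorted i<L)
    where
    open BoundedRPPRows rows

  module _ {P : List (List ℕ)} (rows : BoundedRPPRows λ' μ P) where
    open BoundedRPPRows rows

    private
      decoded : ℕ → List Bool
      decoded i = decodeRow μ₁ (o i) (row P i)

      row-decoded : ∀ {i} → i < L → row (decodeRowsFrom μ 0 P) i ≡ decoded i
      row-decoded {i} i<L = row-decodeRowsFrom μ 0 P i (subst (i <_) (sym length-rows) i<L)

      encode-decoded : ∀ {i} → i < L → encodeRow (o i) (decoded i) ≡ row P i
      encode-decoded {i} i<L = encodeRow-decodeRow μ₁ (o i) (row P i) (boundedRPP-sortedWithin rows i<L)

      buoys-decoded : ∀ {i} → i < L → buoys (decoded i) ≡ part μ i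
      buoys-decoded {i} i<L =
        trans (buoys-decodeRow μ₁ (o i) (row P i) (boundedRPP-sortedWithin rows i<L)) (μ₁∸o i)

      μ-positive : ∀ {i} → i < L → row P i ≡ [] → 0 < part μ i
      μ-positive {i} i<L e = ≤-trans (part-positive (proj₂ pλ) i<L)
        (m∸n≡0⇒m≤n (trans (sym (length-row i<L)) (cong length e)))

      columnWeak-decoded : ∀ {i} → suc i < L →
        ColumnWeak (drop-μ i) (encodeRow (o i) (decoded i)) (encodeRow (o (suc i)) (decoded (suc i)))
      columnWeak-decoded {i} si<L j v e = above (<⇒nth-just (row P i) j j<)
        where
        i<L = <-trans (n<1+n i) si<L
        e′ : nth (row P (suc i)) (drop-μ i + j) ≡ just v
        e′ = subst (λ r → nth r (drop-μ i + j) ≡ just v) (encode-decoded si<L) e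
        j< : j < length (row P i)
        j< = subst (j <_) (sym (length-row i<L)) (skew-index-above (part-suc-≤ aλ i) (part-suc-≤ aμ i)
               (μ⊆λ (suc i)) (subst (drop-μ i + j <_) (length-row si<L) (nth-just⇒< (row P (suc i)) _ e′)))
        above : Σ ℕ (λ u → nth (row P i) j ≡ just u) →
                Σ ℕ λ u → nth (encodeRow (o i) (decoded i)) j ≡ just u × u ≤ v
        above (u , eᵤ) = u , trans (cong (λ r → nth r j) (encode-decoded i<L)) eᵤ , column-sorted si<L eᵤ e′

      bracketed-decoded : ∀ {i} → suc i < L → pairScan 0 (decoded i) (decoded (suc i)) ≡ 0
      bracketed-decoded {i} si<L = dominates⇒pairScan≡0 0 (decoded i) (decoded (suc i))
        (subst₂ _≤_ (sym (buoys-decoded si<L)) (sym (buoys-decoded i<L)) (part-suc-≤ aμ i))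
        (subst (λ s → Dominates s (decoded i) (decoded (suc i)))
               (sym (cong₂ _∸_ (buoys-decoded i<L) (buoys-decoded si<L)))
               (columnWeak⇒dominates (o i) (decoded i) (o (suc i)) (decoded (suc i)) (drop-μ i) (o+drop i)
                                     (columnWeak-decoded si<L)))
        where
        i<L = <-trans (n<1+n i) si<L

    boundedRPP⇒flags : HighestWeightFlags λ' μ (decodeRowsFrom μ 0 P)
    boundedRPP⇒flags = record
      { length-flags = trans (length-decodeRowsFrom μ 0 P) length-rows
      ; length-row   = λ {i} i<L → trans (cong length (row-decoded i<L))
          (trans (length-decodeRow μ₁ (o i) (row P i) (boundedRPP-sortedWithin rows i<L))
                 (trans (cong₂ _+_ (length-row i<L) (μ₁∸o i)) (m∸n+n≡m (μ⊆λ i))))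
      ; headBuoy-row = λ {i} i<L → subst HeadBuoy (sym (row-decoded i<L))
          (headBuoy-decodeRow μ₁ (o i) (row P i)
            (λ e → subst (o i <_) (o+μ i) (m<m+n (o i) (μ-positive i<L e)))
            (λ {g} e → subst (_≤ g) (lo≡1+o i) (proj₁ (entry-bounded i<L e))))
      ; buoys-row    = λ i<L → trans (cong buoys (row-decoded i<L)) (buoys-decoded i<L)
      ; bracketed    = λ {i} si<L → subst₂ (λ a b → pairScan 0 a b ≡ 0)
          (sym (row-decoded (<-trans (n<1+n i) si<L))) (sym (row-decoded si<L)) (bracketed-decoded si<L)
      }

  decode-encode-flags : ∀ {F} → HighestWeightFlags λ' μ F → decodeRowsFrom μ 0 (encodeRowsFrom μ 0 F) ≡ F
  decode-encode-flags {F} hw = decodeRowsFrom-encodeRowsFrom μ 0 F (λ {i} i<F →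
    trans (cong (o i +_) (buoys-row (subst (i <_) length-flags i<F))) (o+μ i))
    where open HighestWeightFlags hw

  encode-decode-boundedRPP : ∀ {P} → BoundedRPPRows λ' μ P → encodeRowsFrom μ 0 (decodeRowsFrom μ 0 P) ≡ P
  encode-decode-boundedRPP {P} rows = encodeRowsFrom-decodeRowsFrom μ 0 P (λ {i} i<P →
    boundedRPP-sortedWithin rows (subst (i <_) (BoundedRPPRows.length-rows rows) i<P))

private
  Σ-T-≡ : ∀ {A : Set} (f : A → Bool) {x y} {p : T (f x)} {q : T (f y)} →
          x ≡ y → _≡_ {A = Σ A (T ∘ f)} (x , p) (y , q)
  Σ-T-≡ f refl = cong (_ ,_) (T-irrelevant _ _)

corollary5p10 : (λ' μ : List ℕ) (n : ℕ) → IsPartition λ' → IsPartition μ → μ ⊆ₚ λ' → ℓ λ' ≤ n →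
    HWVST n λ' μ ↔ BoundedRPP λ' μ
corollary5p10 λ' μ n pλ pμ μ⊆λ ℓ≤n = mk↔ₛ′ to from to∘from from∘to
  where
  rpp⁻ = isBoundedRPP⁻ (proj₁ pλ) (proj₁ pμ) μ⊆λ
  rpp⁺ = isBoundedRPP⁺ (proj₁ pλ) (proj₁ pμ) μ⊆λ

  hwFlags : ∀ τ → T (isVST n λ' τ ∧ hasWeight n μ τ ∧ isHighestWeight n τ) → HighestWeightFlags λ' μ (flags τ)
  hwFlags τ = highestWeight-flags {μ = μ} pλ ℓ≤n

  to : HWVST n λ' μ → BoundedRPP λ' μ
  to (τ , hw) = encodeRowsFrom μ 0 (flags τ) ,
                rpp⁺ _ (flags⇒boundedRPP pλ (proj₁ pμ) μ⊆λ (hwFlags τ hw))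

  from : BoundedRPP λ' μ → HWVST n λ' μ
  from (P , t) = constantTableau (decodeRowsFrom μ 0 P) ,
                 constantTableau-isHWVST pλ μ⊆λ ℓ≤n (boundedRPP⇒flags pλ (proj₁ pμ) μ⊆λ (rpp⁻ P t))

  to∘from : ∀ P → to (from P) ≡ P
  to∘from (P , t) = Σ-T-≡ (isBoundedRPP λ' μ)
    (trans (cong (encodeRowsFrom μ 0) (flags-constantRowsFrom 0 (decodeRowsFrom μ 0 P)))
           (encode-decode-boundedRPP pλ (proj₁ pμ) μ⊆λ (rpp⁻ P t)))

  from∘to : ∀ τ → from (to τ) ≡ τ
  from∘to (τ , hw) = Σ-T-≡ (λ τ → isVST n λ' τ ∧ hasWeight n μ τ ∧ isHighestWeight n τ)
    (trans (cong constantTableau (decode-encode-flags pλ (proj₁ pμ) μ⊆λ (hwFlags τ hw)))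
           (sym (highestWeight-constantTableau {μ = μ} {τ = τ} pλ ℓ≤n hw)))
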